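{- Let $1<\gamma\le 15/14$. Let $\mathrm{ALG}$ be a deterministic online list update algorithm with advice such that $\mathrm{ALG}(\sigma)\le\gamma\cdot\mathrm{OPT}(\sigma)$ for every request sequence $\sigma$ (full cost model). Then on inputs of size $n$ (already for a list of two items), $\mathrm{ALG}$ needs to read at least $$\frac{n}{5}\Bigl(1+(7\gamma-7)\log_2(7\gamma-7)+(8-7\gamma)\log_2(8-7\gamma)\Bigr)$$ bits of advice on some input.
   Context: Static list update problem: a list of $l$ distinct items in some initial order; a request sequence $\sigma$ of items is served online in order. Serving a request to the item at position $i$ (from the front) costs $i$ (full cost model). Immediately after an access, the accessed item may be moved closer to the front at no cost (free exchange); at any time two adjacent items may be swapped at cost $1$ (paid exchange). $A(\sigma)$ is the total cost of algorithm $A$ on $\sigma$ and $\mathrm{OPT}(\sigma)$ the minimum cost of any offline algorithm on $\sigma$ from the same initial list. Advice model: before serving, an oracle knowing all of $\sigma$ writes an infinite binary advice tape; the online algorithm may read tape bits at any time, and the number of advice bits read is the length of the shortest prefix of the tape containing all accessed bits. -}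

module Defs where

open import Algebra.Bundles using (CommutativeRing; CommutativeSemiring)
open import Data.Bool.Base using (Bool; if_then_else_)
open import Data.Empty using (⊥-elim)
open import Data.Fin.Base using (Fin; zero; suc)
open import Data.Fin.Properties using (_≟_)
open import Data.Integer.Base as ℤ using (+_; -[1+_])
import Data.Integer.Properties as ℤ
open import Data.List.Base as List using (List; []; _∷_)
open import Data.Nat.Base as ℕ using (ℕ; zero; suc; z≤n; s≤s; pred)
open import Data.Nat.GeneralisedArithmetic using (fold)
import Data.Nat.Coprimality as Coprime
import Data.Nat.Properties as ℕ
open import Data.Product.Base using (Σ; ∃; _×_; _,_; proj₁; proj₂)
open import Data.Rational.Base as ℚ using (ℚ; mkℚ; 0ℚ; 1ℚ; ½; _/_; ↥_; *≤*)
import Data.Rational.Properties as ℚ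
open import Data.Rational.Unnormalised.Base using (mkℚᵘ; *≡*)
open import Data.Rational.Solver using (module +-*-Solver)
open import Data.Sum.Base using (inj₁; inj₂)
open import Data.Vec.Base using (Vec; []; _∷_)
open import Relation.Binary.PropositionalEquality using (_≡_; refl; sym; trans; cong; cong₂; subst; subst₂)
open import Relation.Nullary using (¬_; yes; no; does)

module Arithmetic where

  open import Data.Rational.Base using (_+_; _*_; -_; _-_; ∣_∣; _≤_; _<_)
  open +-*-Solver
  open CommutativeRing ℚ.+-*-commutativeRing using (commutativeSemiring)
  open import Algebra.Definitions.RawSemiring (CommutativeSemiring.rawSemiring commutativeSemiring) public using (_^_)
  open import Algebra.Properties.CommutativeSemiring.Exp commutativeSemiring public using (^-distrib-*; ^-homo-*; ^-assocʳ)



  <⇒≱ : ∀ {p q} → p < q → ¬ (q ≤ p)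
  <⇒≱ p<q q≤p = ℚ.<-irrefl refl (ℚ.<-≤-trans p<q q≤p)

  ι : ℕ → ℚ
  ι n = + n / 1

  ι-raw : ∀ n → ι n ≡ mkℚ (+ n) 0 (Coprime.sym (Coprime.1-coprimeTo n))
  ι-raw n = ℚ.↥p/↧p≡p (mkℚ (+ n) 0 (Coprime.sym (Coprime.1-coprimeTo n)))

  ι-+ : ∀ m n → ι (m ℕ.+ n) ≡ ι m + ι n
  ι-+ m n rewrite ι-raw m | ι-raw n | ℤ.*-identityʳ (+ m) | ℤ.*-identityʳ (+ n) = refl

  ι-* : ∀ m n → ι (m ℕ.* n) ≡ ι m * ι n
  ι-* m n = trans (cong (λ z → z / 1) (ℤ.pos-* m n)) (sym (cong₂ _*_ (ι-raw m) (ι-raw n)))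

  ι-suc : ∀ n → ι (suc n) ≡ 1ℚ + ι n
  ι-suc n = ι-+ 1 n

  ι-^ : ∀ m n → ι (m ℕ.^ n) ≡ ι m ^ n
  ι-^ m zero    = refl
  ι-^ m (suc n) = trans (ι-* m (m ℕ.^ n)) (cong (ι m *_) (ι-^ m n))

  ι-mono : ∀ {m n} → m ℕ.≤ n → ι m ≤ ι n
  ι-mono {m} {n} m≤n rewrite ι-raw m | ι-raw n =
    *≤* (ℤ.*-monoʳ-≤-nonNeg (+ 1) (ℤ.+≤+ m≤n))

  ι-mono-< : ∀ {m n} → m ℕ.< n → ι m < ι n
  ι-mono-< {m} {n} m<n = ℚ.≰⇒> λ n≤m → ℕ.<⇒≱ m<n (cancel n≤m)
    where
    cancel : ι n ≤ ι m → n ℕ.≤ m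
    cancel le rewrite ι-raw m | ι-raw n with le
    ... | *≤* h = ℤ.drop‿+≤+ (subst₂ ℤ._≤_ (ℤ.*-identityʳ (+ n)) (ℤ.*-identityʳ (+ m)) h)

  ι-cancel : ∀ {m n} → ι m ≤ ι n → m ℕ.≤ n
  ι-cancel {m} {n} le = ℕ.≮⇒≥ λ n<m → <⇒≱ (ι-mono-< n<m) le

  0≤ι : ∀ n → 0ℚ ≤ ι n
  0≤ι n = ι-mono {0} {n} z≤n

  0<ι : ∀ n → 0ℚ < ι (suc n)
  0<ι n = ι-mono-< {0} {suc n} (s≤s z≤n)

  0<½ : 0ℚ < ½
  0<½ = ℚ.positive⁻¹ ½

  ≤-by : ∀ {a b} c → 0ℚ ≤ c → a + c ≡ b → a ≤ b
  ≤-by {a} c 0≤c refl = subst (_≤ a + c) (ℚ.+-identityʳ a) (ℚ.+-monoʳ-≤ a 0≤c)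

  0≤- : ∀ {a b} → a ≤ b → 0ℚ ≤ b - a
  0≤- {a} {b} a≤b = subst (_≤ b - a) (ℚ.+-inverseʳ a) (ℚ.+-monoˡ-≤ (- a) a≤b)

  0≤+ : ∀ {a b} → 0ℚ ≤ a → 0ℚ ≤ b → 0ℚ ≤ a + b
  0≤+ p q = ℚ.+-mono-≤ p q

  *-mono : ∀ {a b} c → 0ℚ ≤ c → a ≤ b → c * a ≤ c * b
  *-mono c 0≤c = ℚ.*-monoˡ-≤-nonNeg c {{ℚ.nonNegative 0≤c}}

  0≤* : ∀ {a b} → 0ℚ ≤ a → 0ℚ ≤ b → 0ℚ ≤ a * b
  0≤* {a} {b} p q = subst (_≤ a * b) (ℚ.*-zeroʳ a) (*-mono a p q)

  0<* : ∀ {a b} → 0ℚ < a → 0ℚ < b → 0ℚ < a * b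
  0<* {a} {b} p q = subst (_< a * b) (ℚ.*-zeroʳ a) (ℚ.*-monoʳ-<-pos a {{ℚ.positive p}} q)

  *-mono₂ : ∀ {a b c d} → 0ℚ ≤ a → 0ℚ ≤ d → a ≤ b → c ≤ d → a * c ≤ b * d
  *-mono₂ {a} {b} {c} {d} 0≤a 0≤d a≤b c≤d =
    ℚ.≤-trans (*-mono a 0≤a c≤d) (ℚ.*-monoʳ-≤-nonNeg d {{ℚ.nonNegative 0≤d}} a≤b)

  *-cancel : ∀ {a b} c → 0ℚ < c → c * a ≤ c * b → a ≤ b
  *-cancel c 0<c = ℚ.*-cancelˡ-≤-pos c {{ℚ.positive 0<c}}

  ≤∣∣ : ∀ p → p ≤ ∣ p ∣
  ≤∣∣ p with ℚ.∣p∣≡p∨∣p∣≡-p p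
  ... | inj₁ e = ℚ.≤-reflexive (sym e)
  ... | inj₂ e = ℚ.≤-trans (≤-by (∣ p ∣ - p) lem (solve 2 (λ p q → p :+ (q :- p) := q) refl p ∣ p ∣)) ℚ.≤-refl
    where
    lem : 0ℚ ≤ ∣ p ∣ - p
    lem = subst (λ z → 0ℚ ≤ ∣ p ∣ + z) e (0≤+ (ℚ.0≤∣p∣ p) (ℚ.0≤∣p∣ p))

  ∣∣≤ : ∀ {p e} → p ≤ e → - p ≤ e → ∣ p ∣ ≤ e
  ∣∣≤ {p} a b with ℚ.∣p∣≡p∨∣p∣≡-p p
  ... | inj₁ e = subst (_≤ _) (sym e) a
  ... | inj₂ e = subst (_≤ _) (sym e) b

  ∣-∣-sym : ∀ p q → ∣ p - q ∣ ≡ ∣ q - p ∣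
  ∣-∣-sym p q = trans (sym (ℚ.∣-p∣≡∣p∣ (p - q)))
    (cong ∣_∣ (solve 2 (λ p q → :- (p :- q) := q :- p) refl p q))

  dist≤ : ∀ {p q e} → ∣ p - q ∣ ≤ e → p ≤ q + e
  dist≤ {p} {q} {e} h = ≤-by (e - (p - q)) (0≤- (ℚ.≤-trans (≤∣∣ (p - q)) h))
    (solve 3 (λ p q e → p :+ (e :- (p :- q)) := q :+ e) refl p q e)

  half+half : ∀ e → ½ * e + ½ * e ≡ e
  half+half e = solve 1 (λ e → con ½ :* e :+ con ½ :* e := e) refl e

  0<half : ∀ {e} → 0ℚ < e → 0ℚ < ½ * e
  0<half = 0<* 0<½

  shrink : ∀ B e → 0ℚ ≤ B → 0ℚ < e → Σ ℚ λ d → 0ℚ < d × B * d ≤ e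
  shrink B e 0≤B 0<e = e * i , 0<* 0<e 0<i , le
    where
    C : ℚ
    C = 1ℚ + B
    0<C : 0ℚ < C
    0<C = ℚ.<-≤-trans (ℚ.positive⁻¹ 1ℚ) (≤-by B 0≤B refl)
    instance
      C≢0 : ℚ.NonZero C
      C≢0 = ℚ.>-nonZero 0<C
      posC : ℚ.Positive C
      posC = ℚ.positive 0<C
    i : ℚ
    i = ℚ.1/ C
    0<i : 0ℚ < i
    0<i = ℚ.positive⁻¹ i {{ℚ.1/pos⇒pos C}}
    le : B * (e * i) ≤ e
    le = ≤-by (e * i) (ℚ.<⇒≤ (0<* 0<e 0<i)) (trans
      (solve 3 (λ B e i → B :* (e :* i) :+ e :* i := e :* ((con 1ℚ :+ B) :* i)) refl B e i)
      (trans (cong (e *_) (ℚ.*-inverseʳ C)) (ℚ.*-identityʳ e)))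

  archimedes : ∀ K e → 0ℚ < e → Σ ℕ λ n → ∀ j → n ℕ.≤ j → K ≤ ι j * e
  archimedes K e 0<e = n , bound
    where
    instance
      e≢0 : ℚ.NonZero e
      e≢0 = ℚ.>-nonZero 0<e
    q : ℚ
    q = ∣ K * ℚ.1/ e ∣
    n : ℕ
    n = ℤ.∣ ↥ q ∣
    q≤n : q ≤ ι n
    q≤n = lem (K * ℚ.1/ e)
      where
      lem : ∀ p → ∣ p ∣ ≤ ι ℤ.∣ ↥ ∣ p ∣ ∣
      lem (mkℚ i d c) rewrite ι-raw ℤ.∣ i ∣ = *≤* (ℤ.*-monoˡ-≤-nonNeg (+ ℤ.∣ i ∣) (ℤ.+≤+ (s≤s z≤n)))
    bound : ∀ j → n ℕ.≤ j → K ≤ ι j * e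
    bound j n≤j = subst (_≤ ι j * e) eq
      (ℚ.*-monoʳ-≤-nonNeg e {{ℚ.nonNegative (ℚ.<⇒≤ 0<e)}}
        (ℚ.≤-trans (≤∣∣ (K * ℚ.1/ e)) (ℚ.≤-trans q≤n (ι-mono n≤j))))
      where
      eq : K * ℚ.1/ e * e ≡ K
      eq = trans (ℚ.*-assoc K (ℚ.1/ e) e) (trans (cong (K *_) (ℚ.*-inverseˡ e)) (ℚ.*-identityʳ K))

  0≤^ : ∀ {p} k → 0ℚ ≤ p → 0ℚ ≤ p ^ k
  0≤^ zero    _   = ℚ.nonNegative⁻¹ 1ℚ
  0≤^ (suc k) 0≤p = 0≤* 0≤p (0≤^ k 0≤p)

  0<^ : ∀ {p} k → 0ℚ < p → 0ℚ < p ^ k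
  0<^ zero    _   = ℚ.positive⁻¹ 1ℚ
  0<^ (suc k) 0<p = 0<* 0<p (0<^ k 0<p)

  ^-mono : ∀ {p q} k → 0ℚ ≤ p → p ≤ q → p ^ k ≤ q ^ k
  ^-mono zero    _   _   = ℚ.≤-refl
  ^-mono (suc k) 0≤p p≤q = *-mono₂ 0≤p (0≤^ k (ℚ.≤-trans 0≤p p≤q)) p≤q (^-mono k 0≤p p≤q)

  ^-mono-< : ∀ {p q} k → 0ℚ ≤ p → p < q → p ^ suc k < q ^ suc k
  ^-mono-< {p} {q} k 0≤p p<q = ℚ.≤-<-trans
    (*-mono p 0≤p (^-mono k 0≤p (ℚ.<⇒≤ p<q)))
    (ℚ.*-monoˡ-<-pos (q ^ k) {{ℚ.positive (0<^ k (ℚ.≤-<-trans 0≤p p<q))}} p<q)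

  ^-cancel : ∀ {p q} k → 0ℚ ≤ q → p ^ suc k ≤ q ^ suc k → p ≤ q
  ^-cancel {p} {q} k 0≤q h with p ℚ.≤? q
  ... | yes p≤q = p≤q
  ... | no  p≰q = ⊥-elim (<⇒≱ (^-mono-< k 0≤q (ℚ.≰⇒> p≰q)) h)

  1^ : ∀ k → 1ℚ ^ k ≡ 1ℚ
  1^ zero    = refl
  1^ (suc k) = trans (ℚ.*-identityˡ (1ℚ ^ k)) (1^ k)

  2^ : ℕ → ℚ
  2^ n = ι (2 ℕ.^ n)

  2^-+ : ∀ m n → 2^ (m ℕ.+ n) ≡ 2^ m * 2^ n
  2^-+ m n = trans (cong ι (ℕ.^-distribˡ-+-* 2 m n)) (ι-* (2 ℕ.^ m) (2 ℕ.^ n))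

  2^-^ : ∀ m n → 2^ m ^ n ≡ 2^ (m ℕ.* n)
  2^-^ m n = trans (sym (ι-^ (2 ℕ.^ m) n)) (cong ι (ℕ.^-*-assoc 2 m n))

  0<2^ : ∀ n → 0ℚ < 2^ n
  0<2^ n = ι-mono-< {0} (ℕ.m^n>0 2 n)

  2^-mono : ∀ {m n} → m ℕ.≤ n → 2^ m ≤ 2^ n
  2^-mono m≤n = ι-mono (ℕ.^-monoʳ-≤ 2 m≤n)

  2^-cancel : ∀ {m n} → 2^ m ≤ 2^ n → m ℕ.≤ n
  2^-cancel {m} {n} h = ℕ.≮⇒≥ λ n<m → <⇒≱ (ι-mono-< (ℕ.^-monoʳ-< 2 (s≤s (s≤s z≤n)) n<m)) h

  -- (1 + δ) ^ i ≤ 1 + 2iδ as long as 2iδ ≤ 1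
  bernoulli : ∀ d i → 0ℚ ≤ d → ι (2 ℕ.* i) * d ≤ 1ℚ → (1ℚ + d) ^ i ≤ 1ℚ + ι (2 ℕ.* i) * d
  bernoulli d zero    0≤d h = ≤-by (0ℚ * d) (0≤* ℚ.≤-refl 0≤d) refl
  bernoulli d (suc i) 0≤d h = ℚ.≤-trans
    (*-mono (1ℚ + d) (0≤+ (ℚ.nonNegative⁻¹ 1ℚ) 0≤d) (bernoulli d i 0≤d h′))
    (≤-by (d * (1ℚ - t * d)) (0≤* 0≤d (0≤- h′))
      (trans (solve 2 (λ d t → (con 1ℚ :+ d) :* (con 1ℚ :+ t :* d) :+ d :* (con 1ℚ :- t :* d)
                         := con 1ℚ :+ (con 1ℚ :+ (con 1ℚ :+ t)) :* d) refl d t)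
             (cong (λ z → 1ℚ + z * d) (sym eq))))
    where
    t : ℚ
    t = ι (2 ℕ.* i)
    eq : ι (2 ℕ.* suc i) ≡ 1ℚ + (1ℚ + t)
    eq = trans (cong ι (ℕ.*-suc 2 i)) (trans (ι-suc (suc (2 ℕ.* i))) (cong (λ z → 1ℚ + z) (ι-suc (2 ℕ.* i))))
    h′ : t * d ≤ 1ℚ
    h′ = ℚ.≤-trans (ℚ.*-monoʳ-≤-nonNeg d {{ℚ.nonNegative 0≤d}} (ι-mono (ℕ.*-monoʳ-≤ 2 (ℕ.n≤1+n i)))) h

  close^ : ∀ {p q} e d j → 0ℚ ≤ e → 0ℚ ≤ d → e ≤ q → 0ℚ ≤ p → ι (2 ℕ.* j) * d ≤ 1ℚ →
           p ≤ q + e * d → p ^ j ≤ ι 2 * q ^ j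
  close^ {p} {q} e d j 0≤e 0≤d e≤q 0≤p h p≤ = ℚ.≤-trans (^-mono j 0≤p p≤′)
    (ℚ.≤-trans (ℚ.≤-reflexive (^-distrib-* (1ℚ + d) q j))
      (ℚ.*-monoʳ-≤-nonNeg (q ^ j) {{ℚ.nonNegative (0≤^ j 0≤q)}}
        (ℚ.≤-trans (bernoulli d j 0≤d h) (ℚ.+-monoʳ-≤ 1ℚ h))))
    where
    0≤q : 0ℚ ≤ q
    0≤q = ℚ.≤-trans 0≤e e≤q
    p≤′ : p ≤ (1ℚ + d) * q
    p≤′ = ℚ.≤-trans p≤ (≤-by (d * (q - e)) (0≤* 0≤d (0≤- e≤q))
      (solve 3 (λ d q e → q :+ e :* d :+ d :* (q :- e) := (con 1ℚ :+ d) :* q) refl d q e))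

  log-ℕ : ∀ n → Σ ℕ λ u → 2 ℕ.^ u ℕ.≤ suc n × suc n ℕ.≤ 2 ℕ.^ suc u
  log-ℕ zero = 0 , s≤s z≤n , s≤s z≤n
  log-ℕ (suc n) with log-ℕ n
  ... | u , lo , hi with suc (suc n) ℕ.≤? 2 ℕ.^ suc u
  ... | yes le = u , ℕ.≤-trans lo (ℕ.n≤1+n _) , le
  ... | no  gt = suc u , ℕ.<⇒≤ (ℕ.≰⇒> gt) , ℕ.≤-trans (s≤s hi)
        (ℕ.≤-trans (ℕ.+-monoˡ-≤ x (ℕ.m^n>0 2 (suc u))) (ℕ.+-monoʳ-≤ x (ℕ.m≤m+n x 0)))
    where
    x : ℕ
    x = 2 ℕ.^ suc u

  log-ℚ : ∀ r → 0ℚ < r → Σ ℕ λ u → Σ ℕ λ v → 2^ u ≤ 2^ (suc v) * r × 2^ v * r ≤ 2^ (suc u)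
  log-ℚ r@(mkℚ (+ zero)  d c) 0<r = ⊥-elim (<⇒≱ 0<r (*≤* (ℤ.+≤+ z≤n)))
  log-ℚ r@(mkℚ -[1+ n ]  d c) 0<r = ⊥-elim (<⇒≱ 0<r (*≤* ℤ.-≤+))
  log-ℚ r@(mkℚ (+ suc n) d c) 0<r with log-ℕ n | log-ℕ d
  ... | u , lo , hi | v , lo′ , hi′ = u , v
      , ℚ.≤-trans (ι-mono lo) (ℚ.≤-trans (ℚ.≤-reflexive (sym eq)) (mono (ι-mono hi′)))
      , ℚ.≤-trans (mono (ι-mono lo′)) (ℚ.≤-trans (ℚ.≤-reflexive eq) (ι-mono hi))
    where
    mono : ∀ {a b} → a ≤ b → a * r ≤ b * r
    mono = ℚ.*-monoʳ-≤-nonNeg r {{ℚ.nonNegative (ℚ.<⇒≤ 0<r)}}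
    eq : ι (suc d) * r ≡ ι (suc n)
    eq = trans (cong (_* r) (ι-raw (suc d))) (ℚ.fromℚᵘ-cong {mkℚᵘ (+ suc d ℤ.* + suc n) _} {mkℚᵘ (+ suc n) 0} (*≡* (trans
      (ℤ.*-identityʳ (+ suc d ℤ.* + suc n)) (trans (ℤ.*-comm (+ suc d) (+ suc n))
      (cong (λ z → + suc n ℤ.* + z) (sym (ℕ.*-identityˡ (suc d))))))))

  2+-^ : ∀ u k X j → (2^ u * X ^ j) ^ k ≡ 2^ (u ℕ.* k) * X ^ (j ℕ.* k)
  2+-^ u k X j = trans (^-distrib-* (2^ u) (X ^ j) k) (cong₂ _*_ (2^-^ u k) (^-assocʳ X j k))

  root-lower : ∀ a b k i u v X → 0ℚ ≤ X → suc i ℕ.* a ℕ.+ (2 ℕ.+ v) ℕ.* k ℕ.≤ suc i ℕ.* b ℕ.+ u ℕ.* k →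
               2^ u ≤ 2^ (2 ℕ.+ v) * X ^ suc i → 2^ a ≤ 2^ b * X ^ k
  root-lower a b k i u v X 0≤X le h = ^-cancel i (0≤* (ℚ.<⇒≤ (0<2^ b)) (0≤^ k 0≤X))
    (*-cancel (2^ ((2 ℕ.+ v) ℕ.* k)) (0<2^ ((2 ℕ.+ v) ℕ.* k)) (begin
      C * 2^ a ^ J                              ≡⟨ cong (C *_) (trans (2^-^ a J) (cong 2^ (ℕ.*-comm a J))) ⟩
      C * 2^ (J ℕ.* a)                          ≡⟨ ℚ.*-comm C (2^ (J ℕ.* a)) ⟩
      2^ (J ℕ.* a) * C                          ≡⟨ 2^-+ (J ℕ.* a) ((2 ℕ.+ v) ℕ.* k) ⟨
      2^ (J ℕ.* a ℕ.+ (2 ℕ.+ v) ℕ.* k)          ≤⟨ 2^-mono le ⟩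
      2^ (J ℕ.* b ℕ.+ u ℕ.* k)                  ≡⟨ 2^-+ (J ℕ.* b) (u ℕ.* k) ⟩
      B * 2^ (u ℕ.* k)                          ≡⟨ cong (B *_) (2^-^ u k) ⟨
      B * 2^ u ^ k                              ≤⟨ *-mono B (ℚ.<⇒≤ (0<2^ (J ℕ.* b))) (^-mono k (ℚ.<⇒≤ (0<2^ u)) h) ⟩
      B * (2^ (2 ℕ.+ v) * X ^ J) ^ k            ≡⟨ cong (B *_) (2+-^ (2 ℕ.+ v) k X J) ⟩
      B * (C * X ^ (J ℕ.* k))                   ≡⟨ solve 3 (λ B C Y → B :* (C :* Y) := C :* (B :* Y)) refl B C _ ⟩
      C * (B * X ^ (J ℕ.* k))                   ≡⟨ cong (C *_) (cong₂ (λ p q → 2^ p * X ^ q) (ℕ.*-comm J b) (ℕ.*-comm J k)) ⟩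
      C * (2^ (b ℕ.* J) * X ^ (k ℕ.* J))        ≡⟨ cong (C *_) (2+-^ b J X k) ⟨
      C * (2^ b * X ^ k) ^ J                    ∎))
    where
    open ℚ.≤-Reasoning
    J : ℕ
    J = suc i
    B C : ℚ
    B = 2^ (J ℕ.* b)
    C = 2^ ((2 ℕ.+ v) ℕ.* k)

  root-upper : ∀ a b k i u v X → 0ℚ ≤ X → suc i ℕ.* b ℕ.+ (2 ℕ.+ u) ℕ.* k ℕ.≤ suc i ℕ.* a ℕ.+ v ℕ.* k →
               2^ v * X ^ suc i ≤ 2^ (2 ℕ.+ u) → 2^ b * X ^ k ≤ 2^ a
  root-upper a b k i u v X 0≤X le h = ^-cancel i (ℚ.<⇒≤ (0<2^ a))
    (*-cancel C (0<2^ (v ℕ.* k)) (begin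
      C * (2^ b * X ^ k) ^ J                    ≡⟨ cong (C *_) (2+-^ b J X k) ⟩
      C * (2^ (b ℕ.* J) * X ^ (k ℕ.* J))        ≡⟨ cong (C *_) (cong₂ (λ p q → 2^ p * X ^ q) (ℕ.*-comm b J) (ℕ.*-comm k J)) ⟩
      C * (B * X ^ (J ℕ.* k))                   ≡⟨ solve 3 (λ B C Y → C :* (B :* Y) := B :* (C :* Y)) refl B C _ ⟩
      B * (C * X ^ (J ℕ.* k))                   ≡⟨ cong (B *_) (2+-^ v k X J) ⟨
      B * (2^ v * X ^ J) ^ k                    ≤⟨ *-mono B (ℚ.<⇒≤ (0<2^ (J ℕ.* b)))
                                                     (^-mono k (0≤* (ℚ.<⇒≤ (0<2^ v)) (0≤^ J 0≤X)) h) ⟩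
      B * 2^ (2 ℕ.+ u) ^ k                      ≡⟨ cong (B *_) (2^-^ (2 ℕ.+ u) k) ⟩
      B * 2^ ((2 ℕ.+ u) ℕ.* k)                  ≡⟨ 2^-+ (J ℕ.* b) ((2 ℕ.+ u) ℕ.* k) ⟨
      2^ (J ℕ.* b ℕ.+ (2 ℕ.+ u) ℕ.* k)          ≤⟨ 2^-mono le ⟩
      2^ (J ℕ.* a ℕ.+ v ℕ.* k)                  ≡⟨ 2^-+ (J ℕ.* a) (v ℕ.* k) ⟩
      2^ (J ℕ.* a) * C                          ≡⟨ ℚ.*-comm (2^ (J ℕ.* a)) C ⟩
      C * 2^ (J ℕ.* a)                          ≡⟨ cong (C *_) (trans (2^-^ a J) (cong 2^ (ℕ.*-comm a J))) ⟨
      C * 2^ a ^ J                              ∎))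
    where
    open ℚ.≤-Reasoning
    J : ℕ
    J = suc i
    B C : ℚ
    B = 2^ (J ℕ.* b)
    C = 2^ (v ℕ.* k)

  sandwich : ∀ {u v u′ v′ J K X} → 0ℚ ≤ X →
             2^ u ≤ 2^ (2 ℕ.+ v) * X ^ J → 2^ v′ * X ^ K ≤ 2^ (2 ℕ.+ u′) →
             u ℕ.* K ℕ.+ v′ ℕ.* J ℕ.≤ (2 ℕ.+ v) ℕ.* K ℕ.+ (2 ℕ.+ u′) ℕ.* J
  sandwich {u} {v} {u′} {v′} {J} {K} {X} 0≤X lo hi = 2^-cancel (begin
      2^ (u ℕ.* K ℕ.+ v′ ℕ.* J)              ≡⟨ 2^-+ (u ℕ.* K) (v′ ℕ.* J) ⟩
      2^ (u ℕ.* K) * D                       ≡⟨ cong (_* D) (2^-^ u K) ⟨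
      2^ u ^ K * D                           ≤⟨ ℚ.*-monoʳ-≤-nonNeg D {{ℚ.nonNegative (ℚ.<⇒≤ (0<2^ (v′ ℕ.* J)))}}
                                                  (^-mono K (ℚ.<⇒≤ (0<2^ u)) lo) ⟩
      (2^ (2 ℕ.+ v) * X ^ J) ^ K * D         ≡⟨ cong (_* D) (2+-^ (2 ℕ.+ v) K X J) ⟩
      C * X ^ (J ℕ.* K) * D                  ≡⟨ solve 3 (λ C Y D → C :* Y :* D := C :* (D :* Y)) refl C _ D ⟩
      C * (D * X ^ (J ℕ.* K))                ≡⟨ cong (λ z → C * (D * X ^ z)) (ℕ.*-comm J K) ⟩
      C * (D * X ^ (K ℕ.* J))                ≡⟨ cong (C *_) (2+-^ v′ J X K) ⟨
      C * (2^ v′ * X ^ K) ^ J                ≤⟨ *-mono C (ℚ.<⇒≤ (0<2^ ((2 ℕ.+ v) ℕ.* K)))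
                                                  (^-mono J (0≤* (ℚ.<⇒≤ (0<2^ v′)) (0≤^ K 0≤X)) hi) ⟩
      C * 2^ (2 ℕ.+ u′) ^ J                  ≡⟨ cong (C *_) (2^-^ (2 ℕ.+ u′) J) ⟩
      C * 2^ ((2 ℕ.+ u′) ℕ.* J)              ≡⟨ 2^-+ ((2 ℕ.+ v) ℕ.* K) ((2 ℕ.+ u′) ℕ.* J) ⟨
      2^ ((2 ℕ.+ v) ℕ.* K ℕ.+ (2 ℕ.+ u′) ℕ.* J) ∎)
    where
    open ℚ.≤-Reasoning
    C D : ℚ
    C = 2^ ((2 ℕ.+ v) ℕ.* K)
    D = 2^ (v′ ℕ.* J)

  module _ (i : ℕ) where

    private instance
      ι≢0 : ℚ.NonZero (ι (suc i))
      ι≢0 = ℚ.>-nonZero (0<ι i)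
      ι-pos : ℚ.Positive (ι (suc i))
      ι-pos = ℚ.positive (0<ι i)

    w : ℚ
    w = ℚ.1/ ι (suc i)

    0<w : 0ℚ < w
    0<w = ℚ.positive⁻¹ w {{ℚ.1/pos⇒pos (ι (suc i))}}

    w-inv : ι (suc i) * w ≡ 1ℚ
    w-inv = ℚ.*-inverseʳ (ι (suc i))

  slope : ℕ → ℕ → ℕ → ℚ
  slope u v i = (ι u - ι v) * w i

  slope-* : ∀ u v i → ι (suc i) * slope u v i ≡ ι u - ι v
  slope-* u v i = trans (solve 3 (λ J s w → J :* (s :* w) := s :* (J :* w)) refl (ι (suc i)) (ι u - ι v) (w i))
    (trans (cong ((ι u - ι v) *_) (w-inv i)) (ℚ.*-identityʳ _))

  slope-close : ∀ u v i u′ v′ j →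
                u ℕ.* suc j ℕ.+ v′ ℕ.* suc i ℕ.≤ (2 ℕ.+ v) ℕ.* suc j ℕ.+ (2 ℕ.+ u′) ℕ.* suc i →
                slope u v i - slope u′ v′ j ≤ ι 2 * w i + ι 2 * w j
  slope-close u v i u′ v′ j le = ≤-by c 0≤c (trans
    (solve 8 (λ u v p u′ v′ q J K →
        (u :- v) :* p :- (u′ :- v′) :* q
          :+ p :* q :* ((con (ι 2) :+ v) :* K :+ (con (ι 2) :+ u′) :* J :- (u :* K :+ v′ :* J))
        := (u :- v) :* p :* (con 1ℚ :- K :* q) :- (u′ :- v′) :* q :* (con 1ℚ :- J :* p)
          :+ con (ι 2) :* p :* (K :* q) :+ con (ι 2) :* q :* (J :* p))
        refl (ι u) (ι v) (w i) (ι u′) (ι v′) (w j) (ι (suc i)) (ι (suc j)))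
    (trans (cong₂ (λ s t → (ι u - ι v) * w i * (1ℚ - s) - (ι u′ - ι v′) * w j * (1ℚ - t)
                           + ι 2 * w i * s + ι 2 * w j * t) (w-inv j) (w-inv i))
      (solve 4 (λ a b p q → a :* (con 1ℚ :- con 1ℚ) :- b :* (con 1ℚ :- con 1ℚ)
                             :+ con (ι 2) :* p :* con 1ℚ :+ con (ι 2) :* q :* con 1ℚ
                           := con (ι 2) :* p :+ con (ι 2) :* q)
        refl ((ι u - ι v) * w i) ((ι u′ - ι v′) * w j) (w i) (w j))))
    where
    c : ℚ
    c = w i * w j * ((ι 2 + ι v) * ι (suc j) + (ι 2 + ι u′) * ι (suc i) - (ι u * ι (suc j) + ι v′ * ι (suc i)))
    cast : ∀ a b c d → ι (a ℕ.* b ℕ.+ c ℕ.* d) ≡ ι a * ι b + ι c * ι d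
    cast a b c d = trans (ι-+ (a ℕ.* b) (c ℕ.* d)) (cong₂ _+_ (ι-* a b) (ι-* c d))
    0≤c : 0ℚ ≤ c
    0≤c = 0≤* (0≤* (ℚ.<⇒≤ (0<w i)) (ℚ.<⇒≤ (0<w j))) (0≤- (subst₂ _≤_
      (cast u (suc j) v′ (suc i))
      (trans (cast (2 ℕ.+ v) (suc j) (2 ℕ.+ u′) (suc i))
        (cong₂ (λ s t → s * ι (suc j) + t * ι (suc i)) (ι-+ 2 v) (ι-+ 2 u′)))
      (ι-mono le)))

  clear-lower : ∀ a b k i u v e → ι (2 ℕ.* k) ≤ ι (suc i) * e → ι a + e ≤ ι b + ι k * slope u v i →
                suc i ℕ.* a ℕ.+ (2 ℕ.+ v) ℕ.* k ℕ.≤ suc i ℕ.* b ℕ.+ u ℕ.* k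
  clear-lower a b k i u v e he h = ι-cancel (subst₂ _≤_
    (sym (trans (cast (suc i) a (2 ℕ.+ v) k) (cong (λ s → J * ι a + s * ι k) (ι-+ 2 v))))
    (sym (cast (suc i) b u k))
    (≤-by ((J * e - ι 2 * ι k) + (J * (ι b + ι k * slope u v i) - J * (ι a + e)))
      (0≤+ (0≤- (subst (_≤ J * e) (ι-* 2 k) he)) (0≤- (*-mono J (0≤ι (suc i)) h)))
      (trans (solve 8 (λ J a b k u v e s →
          J :* a :+ (con (ι 2) :+ v) :* k :+ ((J :* e :- con (ι 2) :* k) :+ (J :* (b :+ k :* s) :- J :* (a :+ e)))
          := J :* b :+ v :* k :+ k :* (J :* s)) refl J (ι a) (ι b) (ι k) (ι u) (ι v) e (slope u v i))
        (trans (cong (λ z → J * ι b + ι v * ι k + ι k * z) (slope-* u v i))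
          (solve 5 (λ J b k u v → J :* b :+ v :* k :+ k :* (u :- v) := J :* b :+ u :* k)
            refl J (ι b) (ι k) (ι u) (ι v))))))
    where
    J : ℚ
    J = ι (suc i)
    cast : ∀ a b c d → ι (a ℕ.* b ℕ.+ c ℕ.* d) ≡ ι a * ι b + ι c * ι d
    cast a b c d = trans (ι-+ (a ℕ.* b) (c ℕ.* d)) (cong₂ _+_ (ι-* a b) (ι-* c d))

  clear-upper : ∀ a b k i u v e → ι (2 ℕ.* k) ≤ ι (suc i) * e → ι b + ι k * slope u v i + e ≤ ι a →
                suc i ℕ.* b ℕ.+ (2 ℕ.+ u) ℕ.* k ℕ.≤ suc i ℕ.* a ℕ.+ v ℕ.* k
  clear-upper a b k i u v e he h = ι-cancel (subst₂ _≤_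
    (sym (trans (cast (suc i) b (2 ℕ.+ u) k) (cong (λ s → J * ι b + s * ι k) (ι-+ 2 u))))
    (sym (cast (suc i) a v k))
    (≤-by ((J * e - ι 2 * ι k) + (J * ι a - J * (ι b + ι k * slope u v i + e)))
      (0≤+ (0≤- (subst (_≤ J * e) (ι-* 2 k) he)) (0≤- (*-mono J (0≤ι (suc i)) h)))
      (trans (solve 8 (λ J a b k u v e s →
          J :* b :+ (con (ι 2) :+ u) :* k :+ ((J :* e :- con (ι 2) :* k) :+ (J :* a :- J :* (b :+ k :* s :+ e)))
          := J :* a :+ u :* k :- k :* (J :* s)) refl J (ι a) (ι b) (ι k) (ι u) (ι v) e (slope u v i))
        (trans (cong (λ z → J * ι a + ι u * ι k - ι k * z) (slope-* u v i))
          (solve 5 (λ J a k u v → J :* a :+ u :* k :- k :* (u :- v) := J :* a :+ v :* k)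
            refl J (ι a) (ι k) (ι u) (ι v))))))
    where
    J : ℚ
    J = ι (suc i)
    cast : ∀ a b c d → ι (a ℕ.* b ℕ.+ c ℕ.* d) ≡ ι a * ι b + ι c * ι d
    cast a b c d = trans (ι-+ (a ℕ.* b) (c ℕ.* d)) (cong₂ _+_ (ι-* a b) (ι-* c d))

  lower-step : ∀ u v {p q} → p ≤ ι 2 * q → 2^ u ≤ 2^ (suc v) * p → 2^ u ≤ 2^ (2 ℕ.+ v) * q
  lower-step u v {p} {q} p≤ lo = ℚ.≤-trans lo (ℚ.≤-trans (*-mono (2^ (suc v)) (ℚ.<⇒≤ (0<2^ (suc v))) p≤)
    (ℚ.≤-reflexive (trans (assoc (2^ (suc v)) (ι 2) q) (cong (_* q) (sym (ι-* 2 (2 ℕ.^ suc v)))))))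
    where
    assoc : ∀ a b c → a * (b * c) ≡ b * a * c
    assoc = solve 3 (λ a b c → a :* (b :* c) := b :* a :* c) refl

  upper-step : ∀ u v {p q} → q ≤ ι 2 * p → 2^ v * p ≤ 2^ (suc u) → 2^ v * q ≤ 2^ (2 ℕ.+ u)
  upper-step u v {p} {q} q≤ hi = ℚ.≤-trans (*-mono (2^ v) (ℚ.<⇒≤ (0<2^ v)) q≤)
    (ℚ.≤-trans (ℚ.≤-reflexive (assoc (2^ v) (ι 2) p))
      (ℚ.≤-trans (*-mono (ι 2) (0≤ι 2) hi) (ℚ.≤-reflexive (sym (ι-* 2 (2 ℕ.^ suc u))))))
    where
    assoc : ∀ a b c → a * (b * c) ≡ b * (a * c)
    assoc = solve 3 (λ a b c → a :* (b :* c) := b :* (a :* c)) refl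

IsCauchy : (ℕ → ℚ) → Set
IsCauchy s = ∀ ε → 0ℚ ℚ.< ε → ∃ λ N → ∀ m n → N ℕ.≤ m → N ℕ.≤ n → ℚ.∣ s m ℚ.- s n ∣ ℚ.≤ ε

module CauchyClosure where

  open import Data.Rational.Base using (_+_; _*_; -_; _-_; ∣_∣; _≤_; _<_)
  open +-*-Solver
  open Arithmetic

  const-cauchy : ∀ q → IsCauchy (λ _ → q)
  const-cauchy q ε 0<ε = 0 , λ _ _ _ _ → subst (λ z → ∣ z ∣ ≤ ε) (sym (ℚ.+-inverseʳ q)) (ℚ.<⇒≤ 0<ε)

  +-cauchy : ∀ {s t} → IsCauchy s → IsCauchy t → IsCauchy (λ n → s n + t n)
  +-cauchy {s} {t} cs ct ε 0<ε with cs (½ * ε) (0<half 0<ε) | ct (½ * ε) (0<half 0<ε)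
  ... | M , hs | N , ht = M ℕ.⊔ N , λ m n le le′ → begin
      ∣ (s m + t m) - (s n + t n) ∣   ≡⟨ cong ∣_∣ (solve 4 (λ a b c d → (a :+ b) :- (c :+ d) := (a :- c) :+ (b :- d))
                                           refl (s m) (t m) (s n) (t n)) ⟩
      ∣ (s m - s n) + (t m - t n) ∣   ≤⟨ ℚ.∣p+q∣≤∣p∣+∣q∣ (s m - s n) (t m - t n) ⟩
      ∣ s m - s n ∣ + ∣ t m - t n ∣   ≤⟨ ℚ.+-mono-≤ (hs m n (ℕ.m⊔n≤o⇒m≤o M N le) (ℕ.m⊔n≤o⇒m≤o M N le′))
                                                   (ht m n (ℕ.m⊔n≤o⇒n≤o M N le) (ℕ.m⊔n≤o⇒n≤o M N le′)) ⟩
      ½ * ε + ½ * ε                   ≡⟨ half+half ε ⟩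
      ε                               ∎
    where open ℚ.≤-Reasoning

  neg-cauchy : ∀ {s} → IsCauchy s → IsCauchy (λ n → - s n)
  neg-cauchy {s} cs ε 0<ε with cs ε 0<ε
  ... | N , h = N , λ m n le le′ → subst (_≤ ε)
    (trans (∣-∣-sym (s m) (s n)) (cong ∣_∣ (solve 2 (λ a b → b :- a := (:- a) :- (:- b)) refl (s m) (s n))))
    (h m n le le′)

  bounded : ∀ {s} → IsCauchy s → Σ ℚ λ B → 0ℚ ≤ B × ∃ λ N → ∀ n → N ℕ.≤ n → ∣ s n ∣ ≤ B
  bounded {s} cs with cs 1ℚ (ℚ.positive⁻¹ 1ℚ)
  ... | N , h = 1ℚ + ∣ s N ∣ , 0≤+ (ℚ.nonNegative⁻¹ 1ℚ) (ℚ.0≤∣p∣ (s N)) , N , λ n le → begin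
      ∣ s n ∣                   ≡⟨ cong ∣_∣ (solve 2 (λ a b → a := (a :- b) :+ b) refl (s n) (s N)) ⟩
      ∣ (s n - s N) + s N ∣     ≤⟨ ℚ.∣p+q∣≤∣p∣+∣q∣ (s n - s N) (s N) ⟩
      ∣ s n - s N ∣ + ∣ s N ∣   ≤⟨ ℚ.+-monoˡ-≤ ∣ s N ∣ (h n N le ℕ.≤-refl) ⟩
      1ℚ + ∣ s N ∣              ∎
    where open ℚ.≤-Reasoning

  product-close : ∀ {a b c d B C δ δ′ ε} → 0ℚ ≤ δ → 0ℚ ≤ δ′ → B * δ ≤ ½ * ε → C * δ′ ≤ ½ * ε →
                  ∣ a ∣ ≤ B → ∣ d ∣ ≤ C → ∣ b - d ∣ ≤ δ → ∣ a - c ∣ ≤ δ′ → ∣ a * b - c * d ∣ ≤ ε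
  product-close {a} {b} {c} {d} {B} {C} {δ} {δ′} {ε} 0≤δ 0≤δ′ Bδ Cδ′ aB dC bd ac =
    subst₂ _≤_ (cong ∣_∣ (solve 4 (λ a b c d → a :* (b :- d) :+ d :* (a :- c) := a :* b :- c :* d) refl a b c d))
               (half+half ε)
      (ℚ.≤-trans (ℚ.∣p+q∣≤∣p∣+∣q∣ (a * (b - d)) (d * (a - c))) (ℚ.+-mono-≤
        (ℚ.≤-trans (ℚ.≤-reflexive (ℚ.∣p*q∣≡∣p∣*∣q∣ a (b - d)))
          (ℚ.≤-trans (*-mono₂ (ℚ.0≤∣p∣ a) 0≤δ aB bd) Bδ))
        (ℚ.≤-trans (ℚ.≤-reflexive (ℚ.∣p*q∣≡∣p∣*∣q∣ d (a - c)))
          (ℚ.≤-trans (*-mono₂ (ℚ.0≤∣p∣ d) 0≤δ′ dC ac) Cδ′))))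

  *-cauchy : ∀ {s t} → IsCauchy s → IsCauchy t → IsCauchy (λ n → s n * t n)
  *-cauchy {s} {t} cs ct ε 0<ε =
    let B , 0≤B , M , hB = bounded {s} cs
        C , 0≤C , N , hC = bounded {t} ct
        δ , 0<δ , Bδ     = shrink B (½ * ε) 0≤B (0<half 0<ε)
        δ′ , 0<δ′ , Cδ′  = shrink C (½ * ε) 0≤C (0<half 0<ε)
        P , hP           = ct δ 0<δ
        Q , hQ           = cs δ′ 0<δ′
        M≤ : ∀ {k} → (M ℕ.⊔ N) ℕ.⊔ (P ℕ.⊔ Q) ℕ.≤ k → M ℕ.≤ k
        M≤ le = ℕ.m⊔n≤o⇒m≤o M N (ℕ.m⊔n≤o⇒m≤o (M ℕ.⊔ N) (P ℕ.⊔ Q) le)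
        N≤ : ∀ {k} → (M ℕ.⊔ N) ℕ.⊔ (P ℕ.⊔ Q) ℕ.≤ k → N ℕ.≤ k
        N≤ le = ℕ.m⊔n≤o⇒n≤o M N (ℕ.m⊔n≤o⇒m≤o (M ℕ.⊔ N) (P ℕ.⊔ Q) le)
        P≤ : ∀ {k} → (M ℕ.⊔ N) ℕ.⊔ (P ℕ.⊔ Q) ℕ.≤ k → P ℕ.≤ k
        P≤ le = ℕ.m⊔n≤o⇒m≤o P Q (ℕ.m⊔n≤o⇒n≤o (M ℕ.⊔ N) (P ℕ.⊔ Q) le)
        Q≤ : ∀ {k} → (M ℕ.⊔ N) ℕ.⊔ (P ℕ.⊔ Q) ℕ.≤ k → Q ℕ.≤ k
        Q≤ le = ℕ.m⊔n≤o⇒n≤o P Q (ℕ.m⊔n≤o⇒n≤o (M ℕ.⊔ N) (P ℕ.⊔ Q) le)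
    in (M ℕ.⊔ N) ℕ.⊔ (P ℕ.⊔ Q) , λ m n le le′ →
      product-close {s m} {t m} {s n} {t n} (ℚ.<⇒≤ 0<δ) (ℚ.<⇒≤ 0<δ′) Bδ Cδ′
        (hB m (M≤ le)) (hC n (N≤ le′)) (hP m n (P≤ le) (P≤ le′)) (hQ m n (Q≤ le) (Q≤ le′))

-- Real numbers are Cauchy sequences of rationals; two of them are the same
-- number when each is ≤ℝ the other.
record ℝ : Set where
  constructor limit
  field
    seq    : ℕ → ℚ
    cauchy : IsCauchy seq

open ℝ

infix  4 _<ℝ_ _≤ℝ_
infixl 6 _+ℝ_ _-ℝ_
infixl 7 _*ℝ_
infixr 8 _^ℝ_

fromℚ : ℚ → ℝ
fromℚ q = limit (λ _ → q) (CauchyClosure.const-cauchy q)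

fromℕ : ℕ → ℝ
fromℕ n = fromℚ (+ n / 1)

_+ℝ_ : ℝ → ℝ → ℝ
x +ℝ y = limit (λ n → seq x n ℚ.+ seq y n) (CauchyClosure.+-cauchy {seq x} {seq y} (cauchy x) (cauchy y))

-ℝ_ : ℝ → ℝ
-ℝ x = limit (λ n → ℚ.- seq x n) (CauchyClosure.neg-cauchy {seq x} (cauchy x))

_-ℝ_ : ℝ → ℝ → ℝ
x -ℝ y = x +ℝ (-ℝ y)

_*ℝ_ : ℝ → ℝ → ℝ
x *ℝ y = limit (λ n → seq x n ℚ.* seq y n) (CauchyClosure.*-cauchy {seq x} {seq y} (cauchy x) (cauchy y))

_^ℝ_ : ℝ → ℕ → ℝ
x ^ℝ zero  = fromℕ 1
x ^ℝ suc k = x *ℝ x ^ℝ k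

_<ℝ_ : ℝ → ℝ → Set
x <ℝ y = ∃ λ ε → 0ℚ ℚ.< ε × ∃ λ N → ∀ n → N ℕ.≤ n → seq x n ℚ.+ ε ℚ.≤ seq y n

_≤ℝ_ : ℝ → ℝ → Set
x ≤ℝ y = ∀ ε → 0ℚ ℚ.< ε → ∃ λ N → ∀ n → N ℕ.≤ n → seq x n ℚ.≤ seq y n ℚ.+ ε

-- y = log₂ x, as a statement about rational exponents q = (a - b) / k:
-- 2 ^ q ≤ x whenever q < y, and x ≤ 2 ^ q whenever y < q.  The denominators
-- and the possibly negative a - b are cleared.
record IsLog₂ (x y : ℝ) : Set where
  field
    below : ∀ a b k → fromℕ a <ℝ fromℕ b +ℝ fromℕ k *ℝ y → fromℕ (2 ℕ.^ a) ≤ℝ fromℕ (2 ℕ.^ b) *ℝ x ^ℝ k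
    above : ∀ a b k → fromℕ b +ℝ fromℕ k *ℝ y <ℝ fromℕ a → fromℕ (2 ℕ.^ b) *ℝ x ^ℝ k ≤ℝ fromℕ (2 ℕ.^ a)

module Logarithm (x : ℝ) (0<x : fromℕ 0 <ℝ x) where

  open import Data.Rational.Base using (_+_; _*_; -_; _-_; ∣_∣; _≤_; _<_)
  open +-*-Solver
  open Arithmetic

  e : ℚ
  e = proj₁ 0<x
  0<e : 0ℚ < e
  0<e = proj₁ (proj₂ 0<x)
  M : ℕ
  M = proj₁ (proj₂ (proj₂ 0<x))

  e≤ : ∀ n → M ℕ.≤ n → e ≤ seq x n
  e≤ n le = subst (_≤ seq x n) (ℚ.+-identityˡ e) (proj₂ (proj₂ (proj₂ 0<x)) n le)

  0≤x : ∀ n → M ℕ.≤ n → 0ℚ ≤ seq x n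
  0≤x n le = ℚ.≤-trans (ℚ.<⇒≤ 0<e) (e≤ n le)

  record Approx (i : ℕ) : Set where
    field
      u v N : ℕ
      M≤N   : M ℕ.≤ N
      lower : ∀ n → N ℕ.≤ n → 2^ u ≤ 2^ (2 ℕ.+ v) * seq x n ^ suc i
      upper : ∀ n → N ℕ.≤ n → 2^ v * seq x n ^ suc i ≤ 2^ (2 ℕ.+ u)

  approx-from : ∀ i d L → 0ℚ < d → ι (2 ℕ.* suc i) * d ≤ 1ℚ →
                (∀ m n → L ℕ.≤ m → L ℕ.≤ n → ∣ seq x m - seq x n ∣ ≤ e * d) → Approx i
  approx-from i d L 0<d jd hL = record
    { u = u ; v = v ; N = K ; M≤N = ℕ.m≤m⊔n M L
    ; lower = λ n le → lower-step u v (close K n ℕ.≤-refl le) (proj₁ (proj₂ (proj₂ size)))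
    ; upper = λ n le → upper-step u v (close n K le ℕ.≤-refl) (proj₂ (proj₂ (proj₂ size)))
    }
    where
    K : ℕ
    K = M ℕ.⊔ L
    M≤ : ∀ {n} → K ℕ.≤ n → M ℕ.≤ n
    M≤ = ℕ.m⊔n≤o⇒m≤o M L
    L≤ : ∀ {n} → K ℕ.≤ n → L ℕ.≤ n
    L≤ = ℕ.m⊔n≤o⇒n≤o M L
    close : ∀ m n → K ℕ.≤ m → K ℕ.≤ n → seq x m ^ suc i ≤ ι 2 * seq x n ^ suc i
    close m n le le′ = close^ e d (suc i) (ℚ.<⇒≤ 0<e) (ℚ.<⇒≤ 0<d) (e≤ n (M≤ le′)) (0≤x m (M≤ le)) jd
      (dist≤ (hL m n (L≤ le) (L≤ le′)))
    size : Σ ℕ λ u → Σ ℕ λ v → 2^ u ≤ 2^ (suc v) * seq x K ^ suc i × 2^ v * seq x K ^ suc i ≤ 2^ (suc u)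
    size = log-ℚ (seq x K ^ suc i) (0<^ (suc i) (ℚ.<-≤-trans 0<e (e≤ K (M≤ ℕ.≤-refl))))
    u v : ℕ
    u = proj₁ size
    v = proj₁ (proj₂ size)

  abstract
    approx : ∀ i → Approx i
    approx i =
      let d , 0<d , jd = shrink (ι (2 ℕ.* suc i)) 1ℚ (0≤ι (2 ℕ.* suc i)) (ℚ.positive⁻¹ 1ℚ)
          L , hL = cauchy x (e * d) (0<* 0<e 0<d)
      in approx-from i d L 0<d jd hL

  -- Sequence of approximations (u - v) / (i + 1) with 2 ^ (u - v) within a factor
  -- 4 of x ^ (i + 1).
  module A i = Approx (approx i)

  y : ℕ → ℚ
  y i = slope (A.u i) (A.v i) i

  y-close : ∀ i j → y i - y j ≤ ι 2 * w i + ι 2 * w j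
  y-close i j = slope-close (A.u i) (A.v i) i (A.u j) (A.v j) j
    (sandwich {A.u i} {A.v i} {A.u j} {A.v j} (0≤x n (ℕ.≤-trans (A.M≤N i) i≤)) (A.lower i n i≤) (A.upper j n j≤))
    where
    n : ℕ
    n = A.N i ℕ.⊔ A.N j
    i≤ : A.N i ℕ.≤ n
    i≤ = ℕ.m≤m⊔n (A.N i) (A.N j)
    j≤ : A.N j ℕ.≤ n
    j≤ = ℕ.m≤n⊔m (A.N i) (A.N j)

  y-cauchy : IsCauchy y
  y-cauchy ε 0<ε = N , λ m n le le′ → ∣∣≤ (bound m n le le′)
      (subst (_≤ ε) (flip (y m) (y n)) (bound n m le′ le))
    where
    N : ℕ
    N = proj₁ (archimedes (ι 4) ε 0<ε)
    h : ∀ j → N ℕ.≤ j → ι 4 ≤ ι j * ε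
    h = proj₂ (archimedes (ι 4) ε 0<ε)
    flip : ∀ a b → b - a ≡ - (a - b)
    flip = solve 2 (λ a b → b :- a := :- (a :- b)) refl
    small : ∀ i → N ℕ.≤ i → ι 2 * w i ≤ ½ * ε
    small i le = subst₂ _≤_
      (solve 1 (λ p → con ½ :* p :* con (ι 4) := con (ι 2) :* p) refl (w i))
      (trans (solve 3 (λ p J ε → con ½ :* p :* (J :* ε) := con ½ :* ε :* (J :* p)) refl (w i) (ι (suc i)) ε)
        (trans (cong (λ z → ½ * ε * z) (w-inv i)) (ℚ.*-identityʳ (½ * ε))))
      (*-mono (½ * w i) (ℚ.<⇒≤ (0<half (0<w i))) (h (suc i) (ℕ.≤-trans le (ℕ.n≤1+n i))))
    bound : ∀ m n → N ℕ.≤ m → N ℕ.≤ n → y m - y n ≤ ε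
    bound m n le le′ = ℚ.≤-trans (y-close m n)
      (ℚ.≤-trans (ℚ.+-mono-≤ (small m le) (small n le′)) (ℚ.≤-reflexive (half+half ε)))

  seq-^ : ∀ n k → seq (x ^ℝ k) n ≡ seq x n ^ k
  seq-^ n zero    = refl
  seq-^ n (suc k) = cong (seq x n *_) (seq-^ n k)

  weaken : ∀ {p q} ε → 0ℚ < ε → p ≤ q → p ≤ q + ε
  weaken {p} {q} ε 0<ε p≤q = ℚ.≤-trans p≤q (≤-by ε (ℚ.<⇒≤ 0<ε) refl)

  y-isLog₂ : IsLog₂ x (limit y y-cauchy)
  y-isLog₂ .IsLog₂.below a b k (ε , 0<ε , N , h) ε′ 0<ε′ = A.N i , λ n le → weaken ε′ 0<ε′
      (subst (λ z → 2^ a ≤ 2^ b * z) (sym (seq-^ n k))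
        (root-lower a b k i (A.u i) (A.v i) (seq x n) (0≤x n (ℕ.≤-trans (A.M≤N i) le))
          (clear-lower a b k i (A.u i) (A.v i) ε (hP (suc i) (ℕ.≤-trans (ℕ.m≤n⊔m N P) (ℕ.n≤1+n i))) (h i (ℕ.m≤m⊔n N P)))
          (A.lower i n le)))
    where
    P : ℕ
    P = proj₁ (archimedes (ι (2 ℕ.* k)) ε 0<ε)
    hP : ∀ j → P ℕ.≤ j → ι (2 ℕ.* k) ≤ ι j * ε
    hP = proj₂ (archimedes (ι (2 ℕ.* k)) ε 0<ε)
    i : ℕ
    i = N ℕ.⊔ P
  y-isLog₂ .IsLog₂.above a b k (ε , 0<ε , N , h) ε′ 0<ε′ = A.N i , λ n le → weaken ε′ 0<ε′
      (subst (λ z → 2^ b * z ≤ 2^ a) (sym (seq-^ n k))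
        (root-upper a b k i (A.u i) (A.v i) (seq x n) (0≤x n (ℕ.≤-trans (A.M≤N i) le))
          (clear-upper a b k i (A.u i) (A.v i) ε (hP (suc i) (ℕ.≤-trans (ℕ.m≤n⊔m N P) (ℕ.n≤1+n i))) (h i (ℕ.m≤m⊔n N P)))
          (A.upper i n le)))
    where
    P : ℕ
    P = proj₁ (archimedes (ι (2 ℕ.* k)) ε 0<ε)
    hP : ∀ j → P ℕ.≤ j → ι (2 ℕ.* k) ≤ ι j * ε
    hP = proj₂ (archimedes (ι (2 ℕ.* k)) ε 0<ε)
    i : ℕ
    i = N ℕ.⊔ P

abstract
  log₂-exists : ∀ x → fromℕ 0 <ℝ x → ∃ λ y → IsLog₂ x y
  log₂-exists x 0<x = _ , Logarithm.y-isLog₂ x 0<x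

log₂ : ∀ x → fromℕ 0 <ℝ x → ℝ
log₂ x 0<x = proj₁ (log₂-exists x 0<x)

log₂-isLog₂ : ∀ x (0<x : fromℕ 0 <ℝ x) → IsLog₂ x (log₂ x 0<x)
log₂-isLog₂ x 0<x = proj₂ (log₂-exists x 0<x)

module _ (γ : ℝ) where

  open import Data.Rational.Base using (_+_; _*_; -_; _-_; _≤_; _<_)
  open +-*-Solver
  open Arithmetic

  7γ-7>0 : fromℕ 1 <ℝ γ → fromℕ 0 <ℝ fromℕ 7 *ℝ γ -ℝ fromℕ 7
  7γ-7>0 (ε , 0<ε , N , h) = ι 7 * ε , 0<* (0<ι 6) 0<ε , N , λ n le →
    ≤-by (ι 7 * seq γ n - ι 7 * (1ℚ + ε)) (0≤- (*-mono (ι 7) (0≤ι 7) (h n le))) (lemma (seq γ n) ε)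
    where
    lemma : ∀ g e → ι 0 + ι 7 * e + (ι 7 * g - ι 7 * (1ℚ + e)) ≡ ι 7 * g + - ι 7
    lemma = solve 2 (λ g e → con (ι 0) :+ con (ι 7) :* e :+ (con (ι 7) :* g :- con (ι 7) :* (con 1ℚ :+ e))
                          := con (ι 7) :* g :+ :- con (ι 7)) refl

  8-7γ>0 : γ ≤ℝ fromℚ (+ 15 / 14) → fromℕ 0 <ℝ fromℕ 8 -ℝ fromℕ 7 *ℝ γ
  8-7γ>0 h with h (+ 1 / 28) (ℚ.positive⁻¹ (+ 1 / 28))
  ... | N , hN = + 1 / 4 , ℚ.positive⁻¹ (+ 1 / 4) , N , λ n le →
    ≤-by (ι 7 * (+ 15 / 14 + + 1 / 28) - ι 7 * seq γ n) (0≤- (*-mono (ι 7) (0≤ι 7) (hN n le))) (lemma (seq γ n))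
    where
    lemma : ∀ g → ι 0 + + 1 / 4 + (ι 7 * (+ 15 / 14 + + 1 / 28) - ι 7 * g) ≡ ι 8 + - (ι 7 * g)
    lemma = solve 1 (λ g → con (ι 0) :+ con (+ 1 / 4) :+ (con (ι 7) :* con (+ 15 / 14 + + 1 / 28) :- con (ι 7) :* g)
                        := con (ι 8) :+ :- (con (ι 7) :* g)) refl

-- The items are the elements of Fin l and a list state is a vector, front first.
-- An initial list without repetitions contains every item and stays a
-- permutation, so the empty case of position is never reached from it.
position : ∀ {l n} → Fin l → Vec (Fin l) n → ℕ
position x []       = 0
position x (y ∷ ys) = if does (x ≟ y) then 1 else suc (position x ys)

-- swap i exchanges the items at positions i + 1 and i + 2 (counted from 1).
swap : ∀ {A : Set} {n} → Fin (pred n) → Vec A n → Vec A n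
swap {n = suc (suc _)} zero    (x ∷ y ∷ zs) = y ∷ x ∷ zs
swap {n = suc (suc _)} (suc i) (x ∷ zs)     = x ∷ swap i zs

advance : ∀ {l n} → Fin l → Vec (Fin l) n → Vec (Fin l) n
advance x []           = []
advance x (y ∷ [])     = y ∷ []
advance x (y ∷ z ∷ zs) = if does (x ≟ z) then z ∷ y ∷ zs else y ∷ advance x (z ∷ zs)

-- What is done for one request: paid exchanges, the access, the free exchange
-- bringing the accessed item forward by the given number of places (stopping
-- at the front), and further paid exchanges.
record Action (l : ℕ) : Set where
  field
    before  : List (Fin (pred l))
    forward : ℕ
    after   : List (Fin (pred l))

open Action

swaps : ∀ {A : Set} {n} → Vec A n → List (Fin (pred n)) → Vec A n
swaps = List.foldl (λ L i → swap i L)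

requestCost : ∀ {l} → Vec (Fin l) l → Fin l → Action l → ℕ
requestCost L x a = List.length (before a) ℕ.+ position x (swaps L (before a)) ℕ.+ List.length (after a)

nextList : ∀ {l} → Vec (Fin l) l → Fin l → Action l → Vec (Fin l) l
nextList L x a = swaps (fold (swaps L (before a)) (advance x) (forward a)) (after a)

cost : ∀ {l n} → Vec (Fin l) l → Vec (Fin l) n → Vec (Action l) n → ℕ
cost L []      []       = 0
cost L (x ∷ σ) (a ∷ as) = requestCost L x a ℕ.+ cost (nextList L x a) σ as

record IsOPT {l n} (L₀ : Vec (Fin l) l) (σ : Vec (Fin l) n) (opt : ℕ) : Set where
  field
    attained : ∃ λ as → cost L₀ σ as ≡ opt
    minimal  : ∀ as → opt ℕ.≤ cost L₀ σ as

Tape : Set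
Tape = ℕ → Bool

data Event (l : ℕ) : Set where
  request : Fin l → Event l
  bit     : Bool → Event l

data Decision (l : ℕ) : Set where
  read : ℕ → Decision l
  act  : Action l → Decision l

-- A deterministic strategy sees the requests revealed and the bits read so far,
-- most recent first.  It either inspects a cell of the tape or acts on the
-- current request.  It need not be defined sensibly on histories that the
-- oracle never produces: it may, for instance, read forever.
Strategy : ℕ → Set
Strategy l = List (Event l) → Decision l

-- Responds A φ h a h′ b: from history h, strategy A eventually performs a, the
-- history then being h′ and b the length of the shortest prefix of φ that
-- contains the cells inspected on the way.
data Responds {l} (A : Strategy l) (φ : Tape) (h : List (Event l)) : Action l → List (Event l) → ℕ → Set where
  acts  : ∀ {a} → A h ≡ act a → Responds A φ h a h 0
  reads : ∀ {i a h′ b} → A h ≡ read i → Responds A φ (bit (φ i) ∷ h) a h′ b → Responds A φ h a h′ (suc i ℕ.⊔ b)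

data Run {l} (A : Strategy l) (φ : Tape) (h : List (Event l)) : ∀ {n} → Vec (Fin l) n → Vec (Action l) n → ℕ → Set where
  []  : Run A φ h [] [] 0
  _∷_ : ∀ {n x a h′ b c} {σ : Vec (Fin l) n} {as} →
        Responds A φ (request x ∷ h) a h′ b → Run A φ h′ σ as c → Run A φ h (x ∷ σ) (a ∷ as) (b ℕ.⊔ c)

-- schedule and bitsRead are determined by run, which says that the strategy
-- answers every request of σ when given the tape written for σ.
record AdviceAlgorithm (l : ℕ) : Set where
  field
    strategy : Strategy l
    oracle   : ∀ {n} → Vec (Fin l) n → Tape
    schedule : ∀ {n} → Vec (Fin l) n → Vec (Action l) n
    bitsRead : ∀ {n} → Vec (Fin l) n → ℕ
    run      : ∀ {n} (σ : Vec (Fin l) n) → Run strategy (oracle σ) [] σ (schedule σ) (bitsRead σ)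

  algCost : ∀ {n} → Vec (Fin l) l → Vec (Fin l) n → ℕ
  algCost L₀ σ = cost L₀ σ (schedule σ)

open AdviceAlgorithm public using (algCost; bitsRead)

Competitive : ∀ {l} → ℝ → Vec (Fin l) l → AdviceAlgorithm l → Set
Competitive γ L₀ ALG = ∀ {n} (σ : Vec _ n) opt → IsOPT L₀ σ opt → fromℕ (algCost ALG L₀ σ) ≤ℝ γ *ℝ fromℕ opt

{-# OPTIONS --safe #-}
-- Play on the two front items only, in blocks of three requests: if st is in
-- front and c is the next bit, ask for the item other than st and then twice
-- for c.  Having c in front after the first request serves a block at cost 4,
-- which is optimal; having the other item there costs at least 1 more, even if
-- swaps are carried over between blocks.  So an algorithm is a guesser of the
-- bits who errs on at most (γ - 1) OPT of them.  For a fixed prefix of the advice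
-- tape the guesses are causal, and then the probabilities
-- q ^ errors * (1 - q) ^ (rest) sum to at most 1 over all strings.  Summing over the
-- 2 ^ B prefixes gives 2 ^ m * q ^ e * (1 - q) ^ (m - e) ≤ 2 ^ B for every q ≤ ½, and the
-- bound is the logarithm of this at q = 7 γ - 7.  The slack of blocks of length 3
-- and cost 4 against the 5 and 7 of the bound pays for n not divisible by 3.
-- For n < 3 one bit has to be read, as the first request to the second item
-- cannot be answered uninformed.
module Submission where

open import Defs
open import Data.Bool.Base using (Bool; true; false; not; if_then_else_; _xor_; _∧_)
open import Data.Empty using (⊥; ⊥-elim)
open import Data.Fin.Base using (Fin)
open import Data.Fin.Properties using (_≟_)
open import Data.Integer.Base as ℤ using (+_)
import Data.Integer.Properties as ℤ
open import Data.List.Base using ([]; _∷_; length)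
open import Data.Nat.Base as ℕ using (ℕ; zero; suc; z≤n; s≤s)
open import Data.Nat.DivMod using (m≡m%n+[m/n]*n; m%n<n)
open import Data.Nat.GeneralisedArithmetic using (fold)
import Data.Nat.Properties as ℕ
open import Data.Nat.Tactic.RingSolver using (solve-∀)
open import Data.Product.Base using (∃; _×_; _,_; proj₁; proj₂)
open import Data.Rational.Base as ℚ using (ℚ; 0ℚ; 1ℚ; ½; _/_)
import Data.Rational.Properties as ℚ
open import Data.Rational.Solver using (module +-*-Solver)
open import Data.Rational.Unnormalised.Base as ℚᵘ using (mkℚᵘ)
import Data.Rational.Unnormalised.Properties as ℚᵘ
open import Data.Sum.Base using (_⊎_; inj₁; inj₂)
open import Data.Unit.Base using (⊤; tt)
open import Data.Vec.Base using (Vec; []; _∷_; head; tail; replicate)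
open import Data.Vec.Relation.Unary.All as All using ()
open import Data.Vec.Relation.Unary.AllPairs using (_∷_)
open import Data.Vec.Relation.Unary.Unique.Propositional using (Unique)
open import Relation.Binary.PropositionalEquality using (_≡_; _≢_; refl; sym; trans; cong; cong₂; subst; subst₂)
open import Relation.Nullary using (¬_; Dec; yes; no; does)
open import Relation.Nullary.Decidable using (dec-true; dec-false)

open Action
open ℝ

-- Hamming distance, causal guesses, and determinism under a shared advice prefix.

mismatch : Bool → Bool → ℕ
mismatch a b = if a xor b then 1 else 0

mismatch-refl : ∀ a → mismatch a a ≡ 0
mismatch-refl true  = refl
mismatch-refl false = refl

mismatch≤1 : ∀ a b → mismatch a b ℕ.≤ 1
mismatch≤1 true  true  = z≤n
mismatch≤1 true  false = ℕ.≤-refl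
mismatch≤1 false true  = ℕ.≤-refl
mismatch≤1 false false = z≤n

mismatch-not : ∀ a b → mismatch a b ℕ.+ mismatch a (not b) ≡ 1
mismatch-not true  true  = refl
mismatch-not true  false = refl
mismatch-not false true  = refl
mismatch-not false false = refl

mismatch-antitone : ∀ {a b c} → (a ≡ c → b ≡ c) → mismatch b c ℕ.≤ mismatch a c
mismatch-antitone {true}  {b} {true}  h rewrite h refl = z≤n
mismatch-antitone {false} {b} {false} h rewrite h refl = z≤n
mismatch-antitone {true}  {b} {false} h = mismatch≤1 b false
mismatch-antitone {false} {b} {true}  h = mismatch≤1 b true

distance : ∀ {m} → Vec Bool m → Vec Bool m → ℕ
distance []      v = 0
distance (c ∷ s) v = mismatch (head v) c ℕ.+ distance s (tail v)

distance≤ : ∀ {m} (s v : Vec Bool m) → distance s v ℕ.≤ m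
distance≤ []      v = z≤n
distance≤ (c ∷ s) v = ℕ.+-mono-≤ (mismatch≤1 (head v) c) (distance≤ s (tail v))

-- The guesses v for s and v′ for s′ were made by one online guesser, who
-- learns each bit after guessing it.
Causal : ∀ {m} → Vec Bool m → Vec Bool m → Vec Bool m → Vec Bool m → Set
Causal []      v []        v′ = ⊤
Causal (c ∷ s) v (c′ ∷ s′) v′ = head v ≡ head v′ × (c ≡ c′ → Causal s (tail v) s′ (tail v′))

module _ {l} {A : Strategy l} {φ φ′ : Tape} {B : ℕ} (same : ∀ i → i ℕ.< B → φ i ≡ φ′ i) where

  -- Induction on the cells read. Every inspected cell lies below `B`, where the tapes agree, so
  -- both histories grow by the same bit, and `A` is a function of the history.
  responds-unique : ∀ {h a a′ h₁ h₁′ b b′} → b ℕ.≤ B → b′ ℕ.≤ B →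
                    Responds A φ h a h₁ b → Responds A φ′ h a′ h₁′ b′ → a ≡ a′ × h₁ ≡ h₁′
  responds-unique _  _   (acts p) (acts p′) with trans (sym p) p′
  ... | refl = refl , refl
  responds-unique _  _   (acts p) (reads p′ _) with trans (sym p) p′
  ... | ()
  responds-unique _  _   (reads p _) (acts p′) with trans (sym p) p′
  ... | ()
  responds-unique {h} le le′ (reads {i} {b = b} p R) (reads {b = b′} p′ R′) with trans (sym p) p′
  ... | refl = responds-unique (ℕ.m⊔n≤o⇒n≤o (suc i) b le) (ℕ.m⊔n≤o⇒n≤o (suc i) b′ le′) R
    (subst (λ z → Responds A φ′ (bit z ∷ h) _ _ b′) (sym (same i (ℕ.m⊔n≤o⇒m≤o (suc i) b le))) R′)

-- Block sequences on two items: cost of an arbitrary schedule and of OPT.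

module TwoItems {k : ℕ} {x y : Fin (suc (suc k))} (x≢y : x ≢ y) where

  private
    l : ℕ
    l = suc (suc k)

  item : Bool → Fin l
  item true  = x
  item false = y

  item-distinct : ∀ c → item c ≢ item (not c)
  item-distinct true  = x≢y
  item-distinct false = λ e → x≢y (sym e)

  -- The whole list state enters the argument through this bit alone. The other items may be moved
  -- around at will.
  ahead : ∀ {n} → Vec (Fin l) n → Bool
  ahead []       = true
  ahead (z ∷ zs) = if does (z ≟ x) then true else if does (z ≟ y) then false else ahead zs

  ahead-item : ∀ {n} c (zs : Vec (Fin l) n) → ahead (item c ∷ zs) ≡ c
  ahead-item true  zs rewrite dec-true (x ≟ x) refl = refl
  ahead-item false zs rewrite dec-false (y ≟ x) (item-distinct false) | dec-true (y ≟ y) refl = refl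

  ahead-other : ∀ {n z} (zs : Vec (Fin l) n) → (∀ c → z ≢ item c) → ahead (z ∷ zs) ≡ ahead zs
  ahead-other {z = z} zs ≢ rewrite dec-false (z ≟ x) (≢ true) | dec-false (z ≟ y) (≢ false) = refl

  item? : ∀ z → (∃ λ c → z ≡ item c) ⊎ (∀ c → z ≢ item c)
  item? z with z ≟ x | z ≟ y
  ... | yes e | _     = inj₁ (true , e)
  ... | no  _ | yes e = inj₁ (false , e)
  ... | no  p | no q  = inj₂ λ { true → p ; false → q }

  ahead-∷ : ∀ {m n} c z (L : Vec (Fin l) m) (M : Vec (Fin l) n) →
            (ahead L ≡ c → ahead M ≡ c) → ahead (z ∷ L) ≡ c → ahead (z ∷ M) ≡ c
  ahead-∷ c z L M f h with item? z
  ... | inj₁ (d , refl) = trans (ahead-item d M) (trans (sym (ahead-item d L)) h)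
  ... | inj₂ ≢          = trans (ahead-other M ≢) (f (trans (sym (ahead-other L ≢)) h))

  -- A free exchange only swaps `item c` with the entry just before it, so it may gain the lead for
  -- `item c` but never lose it.
  ahead-advance : ∀ {n} c (L : Vec (Fin l) n) → ahead L ≡ c → ahead (advance (item c) L) ≡ c
  ahead-advance c []           h = h
  ahead-advance c (z ∷ [])     h = h
  ahead-advance c (z ∷ v ∷ zs) h with item c ≟ v | ahead-advance c (v ∷ zs)
  ... | yes refl | _  = ahead-item c (z ∷ zs)
  ... | no  _    | ih = ahead-∷ c z (v ∷ zs) (advance (item c) (v ∷ zs)) ih h

  ahead-fold : ∀ {n} c f (L : Vec (Fin l) n) → ahead L ≡ c → ahead (fold L (advance (item c)) f) ≡ c
  ahead-fold c zero    L h = h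
  ahead-fold c (suc f) L h = ahead-advance c (fold L (advance (item c)) f) (ahead-fold c f L h)

  position>0 : ∀ {n} z (L : Vec (Fin l) (suc n)) → 1 ℕ.≤ position z L
  position>0 z (w ∷ L) with z ≟ w
  ... | yes _ = ℕ.≤-refl
  ... | no  _ = s≤s z≤n

  -- Position 1 means that `item c` is in front, hence ahead. This covers vectors missing the item,
  -- whose `position` is then the length and so at least 2, and thus arbitrary list states.
  position≥ : ∀ {n} c (L : Vec (Fin l) (suc (suc n))) → suc (mismatch (ahead L) c) ℕ.≤ position (item c) L
  position≥ c (z ∷ v ∷ zs) with item c ≟ z
  ... | yes refl rewrite ahead-item c (v ∷ zs) | mismatch-refl c = ℕ.≤-refl
  ... | no  _    = s≤s (ℕ.≤-trans (mismatch≤1 (ahead (z ∷ v ∷ zs)) c) (position>0 (item c) (v ∷ zs)))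

  -- A paid exchange before the access already raises the cost to 2, the largest possible left side;
  -- without one, the access happens in `L` itself.
  requestCost-before : ∀ L c a → suc (mismatch (ahead L) c) ℕ.≤ requestCost L (item c) a
  requestCost-before L c record { before = [] ; after = as } =
    ℕ.≤-trans (position≥ c L) (ℕ.m≤m+n _ (length as))
  requestCost-before L c record { before = b ∷ bs ; after = as } = s≤s
    (ℕ.≤-trans (mismatch≤1 (ahead L) c)
      (ℕ.≤-trans (position>0 (item c) (swaps L (b ∷ bs)))
        (ℕ.≤-trans (ℕ.m≤n+m _ (length bs)) (ℕ.m≤m+n _ (length as)))))

  -- Again a paid exchange, now after the access, brings the cost to 2. Without one, the list left
  -- behind differs from the accessed list `M` by free exchanges only, which keep `item c` ahead if
  -- it was.
  requestCost-after : ∀ L c a → suc (mismatch (ahead (nextList L (item c) a)) c) ℕ.≤ requestCost L (item c) a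
  requestCost-after L c record { before = bs ; forward = f ; after = [] } =
    ℕ.≤-trans (s≤s (mismatch-antitone (ahead-fold c f M)))
      (ℕ.≤-trans (position≥ c M) (ℕ.≤-trans (ℕ.m≤n+m _ (length bs)) (ℕ.m≤m+n _ 0)))
    where
    M : Vec (Fin l) l
    M = swaps L bs
  requestCost-after L c a@record { before = bs ; after = d ∷ ds } =
    ℕ.≤-trans (s≤s (mismatch≤1 (ahead (nextList L (item c) a)) c))
      (ℕ.+-mono-≤ (ℕ.≤-trans (position>0 (item c) (swaps L bs)) (ℕ.m≤n+m _ (length bs))) (s≤s (z≤n {length ds})))

  -- The bits of s are the items that should come to the front, block by block.
  requests : ∀ {m} r → Bool → Vec Bool m → Vec (Fin l) (m ℕ.* 3 ℕ.+ r)
  requests r st []      = replicate r (item st)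
  requests r st (c ∷ s) = item (not st) ∷ item c ∷ item c ∷ requests r c s

  -- The guess is read off after the answer to the first request of a block, the last moment at
  -- which the requests have not yet revealed `c`.
  guesses : ∀ {m} r → Vec (Fin l) l → Bool → Vec Bool m → Vec (Action l) (m ℕ.* 3 ℕ.+ r) → Vec Bool m
  guesses r L st []      as                  = []
  guesses r L st (c ∷ s) (a₁ ∷ a₂ ∷ a₃ ∷ as) = ahead L₁ ∷ guesses r L₃ c s as
    where
    L₁ L₃ : Vec (Fin l) l
    L₁ = nextList L (item (not st)) a₁
    L₃ = nextList (nextList L₁ (item c) a₂) (item c) a₃

  -- Being in the wrong state is worth at most the one swap that leads there,
  -- so it serves as a potential.
  cost-lower : ∀ {m} r L st (s : Vec Bool m) as →
               m ℕ.* 4 ℕ.+ r ℕ.+ distance s (guesses r L st s as) ℕ.≤ mismatch (ahead L) st ℕ.+ cost L (requests r st s) as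
  cost-lower r L st [] as = ℕ.≤-trans (ℕ.≤-reflexive (ℕ.+-identityʳ r))
    (ℕ.≤-trans (padding r L as) (ℕ.m≤n+m _ (mismatch (ahead L) st)))
    where
    padding : ∀ r L as → r ℕ.≤ cost L (replicate r (item st)) as
    padding zero    L []       = z≤n
    padding (suc r) L (a ∷ as) = ℕ.+-mono-≤ (ℕ.≤-trans (s≤s z≤n) (requestCost-before L st a)) (padding r _ as)
  cost-lower {suc m} r L st (c ∷ s) (a₁ ∷ a₂ ∷ a₃ ∷ as) = begin
    4 ℕ.+ m ℕ.* 4 ℕ.+ r ℕ.+ (μ ℕ.+ D)                     ≡⟨ lhs (m ℕ.* 4) r μ D ⟩
    -- The second request is charged for the state it finds, which is the guess; the third for the
    -- state it leaves, which is the potential of the next block.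
    2 ℕ.+ ((1 ℕ.+ μ) ℕ.+ (1 ℕ.+ (m ℕ.* 4 ℕ.+ r ℕ.+ D)))   ≤⟨ ℕ.+-mono-≤ first (ℕ.+-mono-≤ (requestCost-before L₁ c a₂)
                                                               (ℕ.+-monoʳ-≤ 1 (cost-lower r L₃ c s as))) ⟩
    (ψ ℕ.+ k₁) ℕ.+ (k₂ ℕ.+ ((1 ℕ.+ μ₃) ℕ.+ C))            ≤⟨ ℕ.+-monoʳ-≤ (ψ ℕ.+ k₁) (ℕ.+-monoʳ-≤ k₂
                                                               (ℕ.+-monoˡ-≤ C (requestCost-after L₂ c a₃))) ⟩
    (ψ ℕ.+ k₁) ℕ.+ (k₂ ℕ.+ (k₃ ℕ.+ C))                    ≡⟨ ℕ.+-assoc ψ k₁ _ ⟩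
    ψ ℕ.+ (k₁ ℕ.+ (k₂ ℕ.+ (k₃ ℕ.+ C)))                    ∎
    where
    open ℕ.≤-Reasoning
    L₁ L₂ L₃ : Vec (Fin l) l
    L₁ = nextList L (item (not st)) a₁
    L₂ = nextList L₁ (item c) a₂
    L₃ = nextList L₂ (item c) a₃
    k₁ k₂ k₃ C D μ μ₃ ψ : ℕ
    k₁ = requestCost L (item (not st)) a₁
    k₂ = requestCost L₁ (item c) a₂
    k₃ = requestCost L₂ (item c) a₃
    C  = cost L₃ (requests r c s) as
    D  = distance s (guesses r L₃ c s as)
    μ  = mismatch (ahead L₁) c
    μ₃ = mismatch (ahead L₃) c
    ψ  = mismatch (ahead L) st
    lhs : ∀ p r μ D → 4 ℕ.+ p ℕ.+ r ℕ.+ (μ ℕ.+ D) ≡ 2 ℕ.+ ((1 ℕ.+ μ) ℕ.+ (1 ℕ.+ (p ℕ.+ r ℕ.+ D)))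
    lhs = solve-∀
    -- The list disagrees with exactly one of `st` and `not st`: either the first request costs 2 or
    -- the potential adds the missing 1.
    first : 2 ℕ.≤ ψ ℕ.+ k₁
    first = ℕ.≤-trans
      (ℕ.≤-reflexive (trans (cong suc (sym (mismatch-not (ahead L) st))) (sym (ℕ.+-suc ψ _))))
      (ℕ.+-monoʳ-≤ ψ (requestCost-before L (not st) a₁))

  module _ (rest : Vec (Fin l) k) where

    listFrom : Bool → Vec (Fin l) l
    listFrom c = item c ∷ item (not c) ∷ rest

    ahead-listFrom : ∀ c → ahead (listFrom c) ≡ c
    ahead-listFrom c = ahead-item c (item (not c) ∷ rest)

    forwards : ℕ → Action l
    forwards f = record { before = [] ; forward = f ; after = [] }

    -- The first request of a block hits the second item. It is moved to the front exactly when it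
    -- is also the next bit, that is when `st` and `c` differ, so a block costs 2 + 1 + 1.
    ideal : ∀ {m} r → Bool → Vec Bool m → Vec (Action l) (m ℕ.* 3 ℕ.+ r)
    ideal r st []      = replicate r (forwards 0)
    ideal r st (c ∷ s) = forwards (mismatch st c) ∷ forwards 0 ∷ forwards 0 ∷ ideal r c s

    front-cost : ∀ c → requestCost (listFrom c) (item c) (forwards 0) ≡ 1
    front-cost c rewrite dec-true (item c ≟ item c) refl = refl

    back-cost : ∀ c f → requestCost (listFrom c) (item (not c)) (forwards f) ≡ 2
    back-cost c f
      rewrite dec-false (item (not c) ≟ item c) (λ e → item-distinct c (sym e))
            | dec-true (item (not c) ≟ item (not c)) refl = refl

    next-list : ∀ st c → nextList (listFrom st) (item (not st)) (forwards (mismatch st c)) ≡ listFrom c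
    next-list true  true  = refl
    next-list true  false rewrite dec-true (y ≟ y) refl = refl
    next-list false true  rewrite dec-true (x ≟ x) refl = refl
    next-list false false = refl

    cost-ideal : ∀ {m} r st (s : Vec Bool m) → cost (listFrom st) (requests r st s) (ideal r st s) ≡ m ℕ.* 4 ℕ.+ r
    cost-ideal r st [] = padding r
      where
      padding : ∀ r → cost (listFrom st) (replicate r (item st)) (replicate r (forwards 0)) ≡ r
      padding zero    = refl
      padding (suc r) = cong₂ ℕ._+_ (front-cost st) (padding r)
    cost-ideal r st (c ∷ s)
      rewrite next-list st c | front-cost c | back-cost st (mismatch st c) | cost-ideal r c s = refl

    errors≤ : ∀ {m} r (s : Vec Bool m) as →
              m ℕ.* 4 ℕ.+ r ℕ.+ distance s (guesses r (listFrom true) true s as) ℕ.≤ cost (listFrom true) (requests r true s) as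
    errors≤ r s as = ℕ.≤-trans (cost-lower r (listFrom true) true s as)
      (ℕ.≤-reflexive (cong (λ z → mismatch z true ℕ.+ cost (listFrom true) (requests r true s) as) (ahead-listFrom true)))

    requests-OPT : ∀ {m} r (s : Vec Bool m) → IsOPT (listFrom true) (requests r true s) (m ℕ.* 4 ℕ.+ r)
    requests-OPT {m} r s = record
      { attained = ideal r true s , cost-ideal r true s
      ; minimal  = λ as → ℕ.≤-trans (ℕ.m≤m+n (m ℕ.* 4 ℕ.+ r) (distance s (guesses r (listFrom true) true s as)))
          (errors≤ r s as)
      }

  module _ {A : Strategy l} {φ φ′ : Tape} {B : ℕ} (same : ∀ i → i ℕ.< B → φ i ≡ φ′ i) where

    -- The first request of a block depends only on the previous bit, so two runs with a common
    -- history answer it alike and make the same guess. If the bits agree, so do the other two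
    -- requests, and the next block starts from a common history again.
    guesses-causal : ∀ {m h b b′} r L st (s s′ : Vec Bool m) {as as′} → b ℕ.≤ B → b′ ℕ.≤ B →
                     Run A φ h (requests r st s) as b → Run A φ′ h (requests r st s′) as′ b′ →
                     Causal s (guesses r L st s as) s′ (guesses r L st s′ as′)
    guesses-causal r L st []      []        le le′ _ _ = tt
    guesses-causal r L st (c ∷ s) (c′ ∷ s′) le le′
      (_∷_ {b = b₁} {c = p₁} R₁ (_∷_ {b = b₂} {c = p₂} R₂ (_∷_ {b = b₃} {c = p₃} R₃ R)))
      (_∷_ {b = b₁′} {c = p₁′} R₁′ (_∷_ {b = b₂′} {c = p₂′} R₂′ (_∷_ {b = b₃′} {c = p₃′} R₃′ R′)))
      with responds-unique same (ℕ.m⊔n≤o⇒m≤o b₁ p₁ le) (ℕ.m⊔n≤o⇒m≤o b₁′ p₁′ le′) R₁ R₁′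
    ... | refl , refl = refl , later
      where
      q₁ : p₁ ℕ.≤ B
      q₁ = ℕ.m⊔n≤o⇒n≤o b₁ p₁ le
      q₁′ : p₁′ ℕ.≤ B
      q₁′ = ℕ.m⊔n≤o⇒n≤o b₁′ p₁′ le′
      q₂ : p₂ ℕ.≤ B
      q₂ = ℕ.m⊔n≤o⇒n≤o b₂ p₂ q₁
      q₂′ : p₂′ ℕ.≤ B
      q₂′ = ℕ.m⊔n≤o⇒n≤o b₂′ p₂′ q₁′
      later : c ≡ c′ → _
      later refl with responds-unique same (ℕ.m⊔n≤o⇒m≤o b₂ p₂ q₁) (ℕ.m⊔n≤o⇒m≤o b₂′ p₂′ q₁′) R₂ R₂′
      ... | refl , refl with responds-unique same (ℕ.m⊔n≤o⇒m≤o b₃ p₃ q₂) (ℕ.m⊔n≤o⇒m≤o b₃′ p₃′ q₂′) R₃ R₃′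
      ... | refl , refl = guesses-causal r _ c s s′ (ℕ.m⊔n≤o⇒n≤o b₃ p₃ q₂) (ℕ.m⊔n≤o⇒n≤o b₃′ p₃′ q₂′) R R′

-- Search and summation over bit strings.

inhabited? : ∀ m (χ : Vec Bool m → Bool) → (∃ λ s → χ s ≡ true) ⊎ (∀ s → χ s ≡ false)
inhabited? zero χ with χ [] in eq
... | true  = inj₁ ([] , eq)
... | false = inj₂ λ { [] → eq }
inhabited? (suc m) χ with inhabited? m (λ s → χ (true ∷ s)) | inhabited? m (λ s → χ (false ∷ s))
... | inj₁ (s , e) | _            = inj₁ (true ∷ s , e)
... | inj₂ _       | inj₁ (s , e) = inj₁ (false ∷ s , e)
... | inj₂ t       | inj₂ f       = inj₂ λ { (true ∷ s) → t s ; (false ∷ s) → f s }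

maximum : ∀ m (f : Vec Bool m → ℕ) → ∃ λ s → ∀ t → f t ℕ.≤ f s
maximum zero    f = [] , λ { [] → ℕ.≤-refl }
maximum (suc m) f with maximum m (λ s → f (true ∷ s)) | maximum m (λ s → f (false ∷ s))
... | s , p | t , q with ℕ.≤-total (f (true ∷ s)) (f (false ∷ t))
... | inj₁ le = false ∷ t , λ { (true ∷ u) → ℕ.≤-trans (p u) le ; (false ∷ u) → q u }
... | inj₂ ge = true ∷ s , λ { (true ∷ u) → p u ; (false ∷ u) → ℕ.≤-trans (q u) ge }

module Sums where

  open import Data.Rational.Base using (_+_; _*_; _≤_)
  open +-*-Solver
  open Arithmetic

  sum : ∀ m → (Vec Bool m → ℚ) → ℚ
  sum zero    f = f []
  sum (suc m) f = sum m (λ s → f (true ∷ s)) + sum m (λ s → f (false ∷ s))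

  sum-mono : ∀ m {f g} → (∀ s → f s ≤ g s) → sum m f ≤ sum m g
  sum-mono zero    h = h []
  sum-mono (suc m) h = ℚ.+-mono-≤ (sum-mono m (λ s → h (true ∷ s))) (sum-mono m (λ s → h (false ∷ s)))

  sum-+ : ∀ m f g → sum m (λ s → f s + g s) ≡ sum m f + sum m g
  sum-+ zero    f g = refl
  sum-+ (suc m) f g = trans
    (cong₂ _+_ (sum-+ m (λ s → f (true ∷ s)) (λ s → g (true ∷ s))) (sum-+ m (λ s → f (false ∷ s)) (λ s → g (false ∷ s))))
    (solve 4 (λ a b c d → (a :+ b) :+ (c :+ d) := (a :+ c) :+ (b :+ d)) refl
      (sum m (λ s → f (true ∷ s))) (sum m (λ s → g (true ∷ s)))
      (sum m (λ s → f (false ∷ s))) (sum m (λ s → g (false ∷ s))))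

  sum-* : ∀ m c f → sum m (λ s → c * f s) ≡ c * sum m f
  sum-* zero    c f = refl
  sum-* (suc m) c f = trans
    (cong₂ _+_ (sum-* m c (λ s → f (true ∷ s))) (sum-* m c (λ s → f (false ∷ s))))
    (sym (ℚ.*-distribˡ-+ c _ _))

  sum-const : ∀ m c → sum m (λ _ → c) ≡ 2^ m * c
  sum-const zero    c = sym (ℚ.*-identityˡ c)
  sum-const (suc m) c = trans (cong₂ _+_ (sum-const m c) (sum-const m c))
    (trans (solve 2 (λ t c → t :* c :+ t :* c := con (ι 2) :* t :* c) refl (2^ m) c)
      (cong (_* c) (sym (ι-* 2 (2 ℕ.^ m)))))

-- Weighted counting of guessers with advice.

module Counting (q : ℚ) (0≤q : 0ℚ ℚ.≤ q) (q≤½ : q ℚ.≤ ½) where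

  open import Data.Rational.Base using (_+_; _*_; _-_; _≤_)
  open +-*-Solver
  open Arithmetic
  open Sums

  q≤1-q : q ≤ 1ℚ - q
  q≤1-q = ≤-by (ι 2 * (½ - q)) (0≤* (0≤ι 2) (0≤- q≤½))
    (solve 1 (λ q → q :+ con (ι 2) :* (con ½ :- q) := con 1ℚ :- q) refl q)

  0≤1-q : 0ℚ ≤ 1ℚ - q
  0≤1-q = ℚ.≤-trans 0≤q q≤1-q

  factor : Bool → Bool → ℚ
  factor g c = if g xor c then q else 1ℚ - q

  0≤factor : ∀ g c → 0ℚ ≤ factor g c
  0≤factor true  true  = 0≤1-q
  0≤factor true  false = 0≤q
  0≤factor false true  = 0≤q
  0≤factor false false = 0≤1-q

  factor-sum : ∀ g → factor g true + factor g false ≡ 1ℚ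
  factor-sum true  = solve 1 (λ q → (con 1ℚ :- q) :+ q := con 1ℚ) refl q
  factor-sum false = solve 1 (λ q → q :+ (con 1ℚ :- q) := con 1ℚ) refl q

  -- The probability of `s` when each bit refutes its guess with probability `q`. Taking `v` apart
  -- by `head` and `tail` lets this unfold at `G (c ∷ s)` for an abstract `G`.
  weight : ∀ {m} → Vec Bool m → Vec Bool m → ℚ
  weight []      v = 1ℚ
  weight (c ∷ s) v = factor (head v) c * weight s (tail v)

  0≤weight : ∀ {m} (s v : Vec Bool m) → 0ℚ ≤ weight s v
  0≤weight []      v = ℚ.nonNegative⁻¹ 1ℚ
  0≤weight (c ∷ s) v = 0≤* (0≤factor (head v) c) (0≤weight s (tail v))

  -- Since `q ≤ 1 - q`, counting a right guess as an error only lowers the product, so an upper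
  -- bound `e` on the errors suffices.
  weight≥ : ∀ {m} (s v : Vec Bool m) {e f} → distance s v ℕ.≤ e → e ℕ.+ f ≡ m → q ^ e * (1ℚ - q) ^ f ≤ weight s v
  weight≥ []      v       {zero} {zero} _ _ = ℚ.≤-refl
  weight≥ (c ∷ s) (g ∷ v) {e} {f} d≤e e+f with g xor c
  weight≥ (c ∷ s) (g ∷ v) {suc e} {f}     d≤e e+f | true = subst (_≤ q * weight s v)
    (sym (ℚ.*-assoc q (q ^ e) ((1ℚ - q) ^ f))) (*-mono q 0≤q (weight≥ s v (ℕ.s≤s⁻¹ d≤e) (ℕ.suc-injective e+f)))
  weight≥ (c ∷ s) (g ∷ v) {e} {suc f}     d≤e e+f | false = subst (_≤ (1ℚ - q) * weight s v)
    (solve 3 (λ p a b → p :* (a :* b) := a :* (p :* b)) refl (1ℚ - q) (q ^ e) ((1ℚ - q) ^ f))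
    (*-mono (1ℚ - q) 0≤1-q (weight≥ s v d≤e (ℕ.suc-injective (trans (sym (ℕ.+-suc e f)) e+f))))
  -- A right guess when only factors `q` are left in the product: one of them is compared with
  -- `1 - q`.
  weight≥ (c ∷ s) (g ∷ v) {suc e} {zero}  d≤e e+f | false = begin
    q * q ^ e * 1ℚ           ≡⟨ ℚ.*-assoc q (q ^ e) 1ℚ ⟩
    q * (q ^ e * 1ℚ)         ≤⟨ *-mono₂ 0≤q (0≤weight s v) q≤1-q
                                 (weight≥ s v {e} {zero} (ℕ.≤-trans (distance≤ s v) (ℕ.≤-reflexive (sym m≡)))
                                                         (trans (ℕ.+-identityʳ e) m≡)) ⟩
    (1ℚ - q) * weight s v    ∎
    where
    open ℚ.≤-Reasoning
    m≡ : e ≡ _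
    m≡ = ℕ.suc-injective (trans (sym (ℕ.+-identityʳ (suc e))) e+f)

  restrict : ∀ {m} → (Vec Bool m → Bool) → (Vec Bool m → Vec Bool m) → Vec Bool m → ℚ
  restrict χ G s = if χ s then weight s (G s) else 0ℚ

  -- Induction on the length. All selected strings share their first guess, so the two halves carry
  -- factors that sum to 1; within a half the first bits agree, so the tails are causal. An empty
  -- selection has no first guess and is treated apart.
  weight-causal : ∀ m χ (G : Vec Bool m → Vec Bool m) →
                  (∀ s s′ → χ s ≡ true → χ s′ ≡ true → Causal s (G s) s′ (G s′)) → sum m (restrict χ G) ≤ 1ℚ
  weight-causal zero χ G _ with χ []
  ... | true  = ℚ.≤-refl
  ... | false = ℚ.nonNegative⁻¹ 1ℚ
  weight-causal (suc m) χ G causal with inhabited? (suc m) χ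
  ... | inj₂ empty = ℚ.≤-trans (sum-mono (suc m) zero≤) (ℚ.≤-trans (ℚ.≤-reflexive (sum-const (suc m) 0ℚ))
        (ℚ.≤-trans (ℚ.≤-reflexive (ℚ.*-zeroʳ (2^ (suc m)))) (ℚ.nonNegative⁻¹ 1ℚ)))
    where
    zero≤ : ∀ s → restrict χ G s ≤ 0ℚ
    zero≤ s rewrite empty s = ℚ.≤-refl
  ... | inj₁ (s₀ , e₀) = ℚ.≤-trans (ℚ.+-mono-≤ (branch true) (branch false)) (ℚ.≤-reflexive (factor-sum g))
    where
    g : Bool
    g = head (G s₀)
    χ′ : Bool → Vec Bool m → Bool
    χ′ c s = χ (c ∷ s)
    G′ : Bool → Vec Bool m → Vec Bool m
    G′ c s = tail (G (c ∷ s))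
    same-head : ∀ s → χ s ≡ true → head (G s) ≡ g
    same-head (c ∷ s) e = go s₀ e₀
      where
      go : ∀ s₁ → χ s₁ ≡ true → head (G (c ∷ s)) ≡ head (G s₁)
      go (c₁ ∷ s₁) e₁ = proj₁ (causal (c ∷ s) (c₁ ∷ s₁) e e₁)
    pointwise : ∀ c s → restrict χ G (c ∷ s) ≤ factor g c * restrict (χ′ c) (G′ c) s
    pointwise c s with χ (c ∷ s) in eq
    ... | true  = ℚ.≤-reflexive (cong (λ z → factor z c * weight s (G′ c s)) (same-head (c ∷ s) eq))
    ... | false = ℚ.≤-reflexive (sym (ℚ.*-zeroʳ (factor g c)))
    branch : ∀ c → sum m (λ s → restrict χ G (c ∷ s)) ≤ factor g c
    branch c = begin
      sum m (λ s → restrict χ G (c ∷ s))                    ≤⟨ sum-mono m (pointwise c) ⟩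
      sum m (λ s → factor g c * restrict (χ′ c) (G′ c) s)   ≡⟨ sum-* m (factor g c) (restrict (χ′ c) (G′ c)) ⟩
      factor g c * sum m (restrict (χ′ c) (G′ c))           ≤⟨ *-mono (factor g c) (0≤factor g c)
                                                                 (weight-causal m (χ′ c) (G′ c) (λ s s′ e e′ →
                                                                   tail-causal s s′ (causal (c ∷ s) (c ∷ s′) e e′))) ⟩
      factor g c * 1ℚ                                       ≡⟨ ℚ.*-identityʳ (factor g c) ⟩
      factor g c                                            ∎
      where
      open ℚ.≤-Reasoning
      tail-causal : ∀ s s′ → Causal (c ∷ s) (G (c ∷ s)) (c ∷ s′) (G (c ∷ s′)) → Causal s (G′ c s) s′ (G′ c s′)
      tail-causal s s′ p = proj₂ p refl

  -- Fixing the content of the last cell of the prefix splits the selection in two; inside each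
  -- part, agreement on one cell fewer is enough. Once all cells are fixed, each of the `2^ B` parts
  -- is a causal family.
  weight-advice : ∀ {m} B χ (φ : Vec Bool m → Tape) G →
                  (∀ s s′ → χ s ≡ true → χ s′ ≡ true → (∀ i → i ℕ.< B → φ s i ≡ φ s′ i) → Causal s (G s) s′ (G s′)) →
                  sum m (restrict χ G) ≤ 2^ B
  weight-advice {m} zero    χ φ G causal = weight-causal m χ G (λ s s′ e e′ → causal s s′ e e′ (λ _ ()))
  weight-advice {m} (suc B) χ φ G causal = begin
    sum m (restrict χ G)                                        ≤⟨ sum-mono m split ⟩
    sum m (λ s → restrict (χ′ true) G s + restrict (χ′ false) G s)
                                                                ≡⟨ sum-+ m (restrict (χ′ true) G) (restrict (χ′ false) G) ⟩
    sum m (restrict (χ′ true) G) + sum m (restrict (χ′ false) G)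
                                                                ≤⟨ ℚ.+-mono-≤ (half true) (half false) ⟩
    2^ B + 2^ B                                                 ≡⟨ solve 1 (λ t → t :+ t := con (ι 2) :* t) refl (2^ B) ⟩
    ι 2 * 2^ B                                                  ≡⟨ ι-* 2 (2 ℕ.^ B) ⟨
    2^ (suc B)                                                  ∎
    where
    open ℚ.≤-Reasoning
    χ′ : Bool → Vec Bool m → Bool
    χ′ b s = χ s ∧ not (φ s B xor b)
    split : ∀ s → restrict χ G s ≤ restrict (χ′ true) G s + restrict (χ′ false) G s
    split s with χ s | φ s B
    ... | false | _     = ℚ.≤-refl
    ... | true  | true  = ℚ.≤-reflexive (sym (ℚ.+-identityʳ _))
    ... | true  | false = ℚ.≤-reflexive (sym (ℚ.+-identityˡ _))
    χ′⇒ : ∀ b s → χ′ b s ≡ true → χ s ≡ true × φ s B ≡ b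
    χ′⇒ b s e with χ s | φ s B
    χ′⇒ true  s e | true | true  = refl , refl
    χ′⇒ false s e | true | false = refl , refl
    half : ∀ b → sum m (restrict (χ′ b) G) ≤ 2^ B
    half b = weight-advice B (χ′ b) φ G λ s s′ e e′ agree →
      causal s s′ (proj₁ (χ′⇒ b s e)) (proj₁ (χ′⇒ b s′ e′)) λ i i<1+B → extend s s′ e e′ agree i (ℕ.m≤n⇒m<n∨m≡n (ℕ.s≤s⁻¹ i<1+B))
      where
      extend : ∀ s s′ → χ′ b s ≡ true → χ′ b s′ ≡ true → (∀ i → i ℕ.< B → φ s i ≡ φ s′ i) →
               ∀ i → i ℕ.< B ⊎ i ≡ B → φ s i ≡ φ s′ i
      extend s s′ e e′ agree i (inj₁ lt)   = agree i lt
      extend s s′ e e′ agree i (inj₂ refl) = trans (proj₂ (χ′⇒ b s e)) (sym (proj₂ (χ′⇒ b s′ e′)))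

  counting : ∀ {m B e f} (φ : Vec Bool m → Tape) G →
             (∀ s s′ → (∀ i → i ℕ.< B → φ s i ≡ φ s′ i) → Causal s (G s) s′ (G s′)) →
             (∀ s → distance s (G s) ℕ.≤ e) → e ℕ.+ f ≡ m → 2^ m * (q ^ e * (1ℚ - q) ^ f) ≤ 2^ B
  counting {m} {B} {e} {f} φ G causal errors e+f = begin
    2^ m * (q ^ e * (1ℚ - q) ^ f)          ≡⟨ sum-const m (q ^ e * (1ℚ - q) ^ f) ⟨
    sum m (λ _ → q ^ e * (1ℚ - q) ^ f)     ≤⟨ sum-mono m (λ s → weight≥ s (G s) (errors s) e+f) ⟩
    sum m (λ s → weight s (G s))           ≤⟨ weight-advice B (λ _ → true) φ G (λ s s′ _ _ → causal s s′) ⟩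
    2^ B                                   ∎
    where open ℚ.≤-Reasoning

-- From powers of two to rational estimates of logarithms.

module LogarithmBounds where

  open import Data.Rational.Base using (_+_; _*_; -_; _-_; ∣_∣; _≤_; _<_)
  open +-*-Solver
  open Arithmetic

  fifth≤ : ∀ {n m} → n ℕ.≤ m ℕ.* 5 → + n / 5 ≤ ι m
  fifth≤ {n} {m} h = ℚ.toℚᵘ-cancel-≤ (ℚᵘ.≤-trans (ℚᵘ.≤-reflexive (ℚ.toℚᵘ-fromℚᵘ (mkℚᵘ (+ n) 4)))
    (ℚᵘ.≤-trans (ℚᵘ.*≤* (ℤ.≤-trans (ℤ.≤-reflexive (ℤ.*-identityʳ (+ n)))
      (ℤ.≤-trans (ℤ.+≤+ h) (ℤ.≤-reflexive (ℤ.pos-* m 5)))))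
      (ℚᵘ.≤-reflexive (ℚᵘ.≃-sym (ℚ.toℚᵘ-fromℚᵘ (mkℚᵘ (+ m) 0))))))

  0≤fifth : ∀ n → 0ℚ ≤ + n / 5
  0≤fifth n = ℚ.nonNegative⁻¹ (+ n / 5) {{ℚ.normalize-nonNeg n 5}}

  floor : ∀ n v → 0ℚ ≤ v → v ≤ ι n → ∃ λ a → ι a ≤ v × v ≤ ι (suc a)
  floor zero    v 0≤v v≤ = 0 , 0≤v , ℚ.≤-trans v≤ (0≤ι 1)
  floor (suc n) v 0≤v v≤ with v ℚ.≤? ι n
  ... | yes le = floor n v 0≤v le
  ... | no  gt = n , ℚ.<⇒≤ (ℚ.≰⇒> gt) , v≤

  -- The integer is written `a - b` to fit `IsLog₂`. The margin 3 will pay one unit each for the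
  -- oscillation of a Cauchy sequence, for the strictness of `_<ℝ_` and for the additive error of
  -- `_≤ℝ_`.
  integer-part : ∀ ρ → ∃ λ a → ∃ λ b → ι a + ι 3 ≤ ι b + ρ × ι b + ρ ≤ ι a + ι 4
  integer-part ρ = a , b
      , ≤-by (v - ι a) (0≤- lo) (solve 3 (λ a s t → a :+ t :+ (s :- t :- a) := s) refl (ι a) (ι b + ρ) (ι 3))
      , ≤-by (ι (suc a) - v) (0≤- hi) (trans (cong (λ z → ι b + ρ + (z - v)) (ι-suc a))
          (solve 2 (λ a s → s :+ (con 1ℚ :+ a :- (s :- con (ι 3))) := a :+ con (ι 4)) refl (ι a) (ι b + ρ)))
    where
    large : ∀ K → ∃ λ n → K ≤ ι n
    large K = let n , h = archimedes K 1ℚ (ℚ.positive⁻¹ 1ℚ) in n , subst (K ≤_) (ℚ.*-identityʳ (ι n)) (h n ℕ.≤-refl)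
    b : ℕ
    b = proj₁ (large (ι 3 - ρ))
    v : ℚ
    v = ι b + ρ - ι 3
    0≤v : 0ℚ ≤ v
    0≤v = subst (0ℚ ≤_) (solve 3 (λ b ρ t → b :- (t :- ρ) := b :+ ρ :- t) refl (ι b) ρ (ι 3))
      (0≤- (proj₂ (large (ι 3 - ρ))))
    a-bounds : ∃ λ a → ι a ≤ v × v ≤ ι (suc a)
    a-bounds = floor (proj₁ (large v)) v 0≤v (proj₂ (large v))
    a : ℕ
    a = proj₁ a-bounds
    lo : ι a ≤ v
    lo = proj₁ (proj₂ a-bounds)
    hi : v ≤ ι (suc a)
    hi = proj₂ (proj₂ a-bounds)

  -- From some index on, `(a - b) / k` underestimates the logarithm by at most `5 / k`.
  log₂-approx : ∀ x (0<x : fromℕ 0 <ℝ x) k → ∃ λ a → ∃ λ b → ∃ λ N → ∀ j → N ℕ.≤ j →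
                2^ a ≤ 2^ b * seq x j ^ k × ι b + ι k * seq (log₂ x 0<x) j ≤ ι a + ι 5
  log₂-approx x 0<x k = from (cauchy (fromℕ k *ℝ log₂ x 0<x) 1ℚ (ℚ.positive⁻¹ 1ℚ))
    where
    R : ℕ → ℚ
    R j = ι k * seq (log₂ x 0<x) j
    from : (∃ λ M → ∀ m n → M ℕ.≤ m → M ℕ.≤ n → ∣ R m - R n ∣ ≤ 1ℚ) →
           ∃ λ a → ∃ λ b → ∃ λ N → ∀ j → N ℕ.≤ j → 2^ a ≤ 2^ b * seq x j ^ k × ι b + R j ≤ ι a + ι 5
    from (M , hM) = between (integer-part (R M))
      where
      between : (∃ λ a → ∃ λ b → ι a + ι 3 ≤ ι b + R M × ι b + R M ≤ ι a + ι 4) →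
                ∃ λ a → ∃ λ b → ∃ λ N → ∀ j → N ℕ.≤ j → 2^ a ≤ 2^ b * seq x j ^ k × ι b + R j ≤ ι a + ι 5
      between (a , b , lo , hi) = a , b , M ℕ.⊔ proj₁ below , λ j le →
          power j (proj₂ below j (ℕ.m⊔n≤o⇒n≤o M (proj₁ below) le)) , near j (ℕ.m⊔n≤o⇒m≤o M (proj₁ below) le)
        where
        far : ∀ j → M ℕ.≤ j → ι (suc a) + 1ℚ ≤ ι b + R j
        far j le = ≤-by ((R j + 1ℚ - R M) + (ι b + R M - (ι a + ι 3)))
          (0≤+ (0≤- (dist≤ {R M} {R j} (hM M j ℕ.≤-refl le))) (0≤- lo))
          (trans (cong (λ z → z + 1ℚ + ((R j + 1ℚ - R M) + (ι b + R M - (ι a + ι 3)))) (ι-suc a))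
            (solve 4 (λ a b r s → con 1ℚ :+ a :+ con 1ℚ :+ ((r :+ con 1ℚ :- s) :+ (b :+ s :- (a :+ con (ι 3)))) := b :+ r)
              refl (ι a) (ι b) (R j) (R M)))
        near : ∀ j → M ℕ.≤ j → ι b + R j ≤ ι a + ι 5
        near j le = ≤-by ((R M + 1ℚ - R j) + (ι a + ι 4 - (ι b + R M)))
          (0≤+ (0≤- (dist≤ {R j} {R M} (hM j M le ℕ.≤-refl))) (0≤- hi))
          (solve 4 (λ a b r s → b :+ r :+ ((s :+ con 1ℚ :- r) :+ (a :+ con (ι 4) :- (b :+ s))) := a :+ con (ι 5))
            refl (ι a) (ι b) (R j) (R M))
        -- The error `2^ a` is half of `2^ (suc a)`, so the other half survives.
        below : ∃ λ N → ∀ j → N ℕ.≤ j → 2^ (suc a) ≤ 2^ b * seq (x ^ℝ k) j + 2^ a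
        below = IsLog₂.below (log₂-isLog₂ x 0<x) (suc a) b k (1ℚ , ℚ.positive⁻¹ 1ℚ , M , far) (2^ a) (0<2^ a)
        power : ∀ j → 2^ (suc a) ≤ 2^ b * seq (x ^ℝ k) j + 2^ a → 2^ a ≤ 2^ b * seq x j ^ k
        power j h = ≤-by (2^ b * seq x j ^ k + 2^ a - 2^ (suc a))
          (0≤- (subst (λ z → 2^ (suc a) ≤ 2^ b * z + 2^ a) (Logarithm.seq-^ x 0<x j k) h))
          (trans (cong (λ z → 2^ a + (2^ b * seq x j ^ k + 2^ a - z)) (ι-* 2 (2 ℕ.^ a)))
            (solve 2 (λ t s → t :+ (s :+ t :- con (ι 2) :* t) := s) refl (2^ a) (2^ b * seq x j ^ k)))

  -- The `k`-th power of the counting inequality contains `q ^ k` and `p ^ k`. Bounding these by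
  -- powers of two leaves a comparison of natural exponents.
  exponents : ∀ {q p m B e f a₁ b₁ a₂ b₂} k → 0ℚ ≤ q → 0ℚ ≤ p → 2^ m * (q ^ e * p ^ f) ≤ 2^ B →
              2^ a₁ ≤ 2^ b₁ * q ^ k → 2^ a₂ ≤ 2^ b₂ * p ^ k →
              m ℕ.* k ℕ.+ (a₁ ℕ.* e ℕ.+ a₂ ℕ.* f) ℕ.≤ B ℕ.* k ℕ.+ (b₁ ℕ.* e ℕ.+ b₂ ℕ.* f)
  exponents {q} {p} {m} {B} {e} {f} {a₁} {b₁} {a₂} {b₂} k 0≤q 0≤p count h₁ h₂ = 2^-cancel (begin
    2^ (m ℕ.* k ℕ.+ (a₁ ℕ.* e ℕ.+ a₂ ℕ.* f))
      ≡⟨ 2^-+ (m ℕ.* k) (a₁ ℕ.* e ℕ.+ a₂ ℕ.* f) ⟩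
    2^ (m ℕ.* k) * 2^ (a₁ ℕ.* e ℕ.+ a₂ ℕ.* f)
      ≡⟨ cong (2^ (m ℕ.* k) *_) (2^-+ (a₁ ℕ.* e) (a₂ ℕ.* f)) ⟩
    2^ (m ℕ.* k) * (2^ (a₁ ℕ.* e) * 2^ (a₂ ℕ.* f))
      ≡⟨ cong₂ (λ u v → 2^ (m ℕ.* k) * (u * v)) (2^-^ a₁ e) (2^-^ a₂ f) ⟨
    2^ (m ℕ.* k) * (2^ a₁ ^ e * 2^ a₂ ^ f)
      ≤⟨ *-mono (2^ (m ℕ.* k)) (ℚ.<⇒≤ (0<2^ (m ℕ.* k)))
           (*-mono₂ (0≤^ e (ℚ.<⇒≤ (0<2^ a₁))) (0≤^ f (0≤* (ℚ.<⇒≤ (0<2^ b₂)) (0≤^ k 0≤p)))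
             (^-mono e (ℚ.<⇒≤ (0<2^ a₁)) h₁) (^-mono f (ℚ.<⇒≤ (0<2^ a₂)) h₂)) ⟩
    2^ (m ℕ.* k) * ((2^ b₁ * q ^ k) ^ e * (2^ b₂ * p ^ k) ^ f)
      ≡⟨ cong₂ (λ u v → 2^ (m ℕ.* k) * (u * v)) (2+-^ b₁ e q k) (2+-^ b₂ f p k) ⟩
    2^ (m ℕ.* k) * ((2^ (b₁ ℕ.* e) * q ^ (k ℕ.* e)) * (2^ (b₂ ℕ.* f) * p ^ (k ℕ.* f)))
      ≡⟨ solve 5 (λ t u v r s → t :* ((u :* r) :* (v :* s)) := u :* v :* (t :* (r :* s))) refl
           (2^ (m ℕ.* k)) (2^ (b₁ ℕ.* e)) (2^ (b₂ ℕ.* f)) (q ^ (k ℕ.* e)) (p ^ (k ℕ.* f)) ⟩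
    D * (2^ (m ℕ.* k) * (q ^ (k ℕ.* e) * p ^ (k ℕ.* f)))
      ≡⟨ cong (D *_) power ⟨
    D * (2^ m * (q ^ e * p ^ f)) ^ k
      ≤⟨ *-mono D (0≤* (ℚ.<⇒≤ (0<2^ (b₁ ℕ.* e))) (ℚ.<⇒≤ (0<2^ (b₂ ℕ.* f))))
           (^-mono k (0≤* (ℚ.<⇒≤ (0<2^ m)) (0≤* (0≤^ e 0≤q) (0≤^ f 0≤p))) count) ⟩
    D * 2^ B ^ k
      ≡⟨ ℚ.*-comm D (2^ B ^ k) ⟩
    2^ B ^ k * D
      ≡⟨ cong₂ _*_ (2^-^ B k) (sym (2^-+ (b₁ ℕ.* e) (b₂ ℕ.* f))) ⟩
    2^ (B ℕ.* k) * 2^ (b₁ ℕ.* e ℕ.+ b₂ ℕ.* f)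
      ≡⟨ 2^-+ (B ℕ.* k) (b₁ ℕ.* e ℕ.+ b₂ ℕ.* f) ⟨
    2^ (B ℕ.* k ℕ.+ (b₁ ℕ.* e ℕ.+ b₂ ℕ.* f)) ∎)
    where
    open ℚ.≤-Reasoning
    D : ℚ
    D = 2^ (b₁ ℕ.* e) * 2^ (b₂ ℕ.* f)
    pow : ∀ x i → (x ^ i) ^ k ≡ x ^ (k ℕ.* i)
    pow x i = trans (^-assocʳ x i k) (cong (x ^_) (ℕ.*-comm i k))
    power : (2^ m * (q ^ e * p ^ f)) ^ k ≡ 2^ (m ℕ.* k) * (q ^ (k ℕ.* e) * p ^ (k ℕ.* f))
    power = trans (^-distrib-* (2^ m) (q ^ e * p ^ f) k) (cong₂ _*_ (2^-^ m k)
      (trans (^-distrib-* (q ^ e) (p ^ f) k) (cong₂ _*_ (pow q e) (pow p f))))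

  -- In terms of P = (a₁ - b₁) / k ≤ R = (a₂ - b₂) / k this is
  -- α log α + (1 - α) log (1 - α) ≲ α P + (1 - α) R ≤ (e / m) P + (f / m) R.
  log-count : ∀ {m B e f a₁ b₁ a₂ b₂ k ε α λ₁ λ₂} → e ℕ.+ f ≡ m → 0ℚ ≤ α → 0ℚ ≤ 1ℚ - α → ι e ≤ ι m * α →
            m ℕ.* suc k ℕ.+ (a₁ ℕ.* e ℕ.+ a₂ ℕ.* f) ℕ.≤ B ℕ.* suc k ℕ.+ (b₁ ℕ.* e ℕ.+ b₂ ℕ.* f) →
            a₁ ℕ.+ b₂ ℕ.≤ a₂ ℕ.+ b₁ →
            ι b₁ + ι (suc k) * λ₁ ≤ ι a₁ + ι 6 → ι b₂ + ι (suc k) * λ₂ ≤ ι a₂ + ι 6 → ι m * ι 6 ≤ ι (suc k) * ε →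
            ι m * (1ℚ + α * λ₁ + (1ℚ - α) * λ₂) ≤ ι B + ε
  log-count {m} {B} {e} {f} {a₁} {b₁} {a₂} {b₂} {k} {ε} {α} {λ₁} {λ₂} refl 0≤α 0≤β he hx hp h₁ h₂ hk =
    *-cancel K (0<ι k) (begin
      K * (ι m * (1ℚ + α * λ₁ + (1ℚ - α) * λ₂))
        ≡⟨ solve 5 (λ K M α l₁ l₂ → K :* (M :* (con 1ℚ :+ α :* l₁ :+ (con 1ℚ :- α) :* l₂))
                     := M :* K :+ M :* (α :* (K :* l₁) :+ (con 1ℚ :- α) :* (K :* l₂))) refl K (ι m) α λ₁ λ₂ ⟩
      ι m * K + ι m * (α * (K * λ₁) + (1ℚ - α) * (K * λ₂))
        ≤⟨ ℚ.+-monoʳ-≤ (ι m * K) (*-mono (ι m) (0≤ι m)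
             (ℚ.+-mono-≤ (*-mono α 0≤α (move h₁)) (*-mono (1ℚ - α) 0≤β (move h₂)))) ⟩
      ι m * K + ι m * (α * P + (1ℚ - α) * R)
        ≤⟨ ℚ.+-monoʳ-≤ (ι m * K) mix ⟩
      ι m * K + (ι e * P + ι f * R)
        ≡⟨ cong (λ z → z * K + (ι e * P + ι f * R)) (ι-+ e f) ⟩
      (ι e + ι f) * K + (ι e * P + ι f * R)
        ≡⟨ solve 5 (λ K e f A D → (e :+ f) :* K :+ (e :* A :+ f :* D) := (e :+ f) :* K :+ (A :* e :+ D :* f)) refl K (ι e) (ι f) P R ⟩
      (ι e + ι f) * K + (P * ι e + R * ι f)
        ≤⟨ ≤-by ((ι B * K + (ι b₁ * ι e + ι b₂ * ι f)) - ((ι e + ι f) * K + (ι a₁ * ι e + ι a₂ * ι f))) (0≤- hx′) (split (ι e) (ι f) ((ι e + ι f) * K)) ⟩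
      ι B * K + (ι e + ι f) * ι 6
        ≡⟨ cong (λ z → ι B * K + z * ι 6) (ι-+ e f) ⟨
      ι B * K + ι m * ι 6
        ≤⟨ ℚ.+-monoʳ-≤ (ι B * K) hk ⟩
      ι B * K + K * ε
        ≡⟨ solve 3 (λ B K ε → B :* K :+ K :* ε := K :* (B :+ ε)) refl (ι B) K ε ⟩
      K * (ι B + ε) ∎)
    where
    open ℚ.≤-Reasoning
    K P R : ℚ
    K = ι (suc k)
    P = ι a₁ + ι 6 - ι b₁
    R = ι a₂ + ι 6 - ι b₂
    move : ∀ {b c d} → b + d ≤ c → d ≤ c - b
    move {b} {c} {d} h = ≤-by (c - (b + d)) (0≤- h) (solve 3 (λ b c d → d :+ (c :- (b :+ d)) := c :- b) refl b c d)
    -- Raising the error fraction from `e / m` to `α` shifts weight from `R` to the smaller `P`.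
    mix : ι m * (α * P + (1ℚ - α) * R) ≤ ι e * P + ι f * R
    mix = subst (λ z → z * (α * P + (1ℚ - α) * R) ≤ ι e * P + ι f * R) (sym (ι-+ e f))
      (≤-by (((ι e + ι f) * α - ι e) * (R - P)) (0≤* (0≤- (subst (λ z → ι e ≤ z * α) (ι-+ e f) he)) (0≤- P≤R))
        (solve 5 (λ e f α A D → (e :+ f) :* (α :* A :+ (con 1ℚ :- α) :* D) :+ ((e :+ f) :* α :- e) :* (D :- A)
                               := e :* A :+ f :* D) refl (ι e) (ι f) α P R))
      where
      P≤R : P ≤ R
      P≤R = ≤-by ((ι a₂ + ι b₁) - (ι a₁ + ι b₂)) (0≤- (subst₂ _≤_ (ι-+ a₁ b₂) (ι-+ a₂ b₁) (ι-mono hp)))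
        (solve 4 (λ a b c d → a :+ con (ι 6) :- b :+ ((c :+ b) :- (a :+ d)) := c :+ con (ι 6) :- d) refl
          (ι a₁) (ι b₁) (ι a₂) (ι b₂))
    cast : ∀ a b c d u v → ι (a ℕ.* b ℕ.+ (c ℕ.* d ℕ.+ u ℕ.* v)) ≡ ι a * ι b + (ι c * ι d + ι u * ι v)
    cast a b c d u v = trans (ι-+ (a ℕ.* b) (c ℕ.* d ℕ.+ u ℕ.* v)) (cong₂ _+_ (ι-* a b)
      (trans (ι-+ (c ℕ.* d) (u ℕ.* v)) (cong₂ _+_ (ι-* c d) (ι-* u v))))
    hx′ : (ι e + ι f) * K + (ι a₁ * ι e + ι a₂ * ι f) ≤ ι B * K + (ι b₁ * ι e + ι b₂ * ι f)
    hx′ = subst₂ _≤_ (trans (cast m (suc k) a₁ e a₂ f) (cong (λ z → z * K + (ι a₁ * ι e + ι a₂ * ι f)) (ι-+ e f)))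
                     (cast B (suc k) b₁ e b₂ f) (ι-mono hx)
    split : ∀ E F L → L + (P * E + R * F) + ((ι B * K + (ι b₁ * E + ι b₂ * F)) - (L + (ι a₁ * E + ι a₂ * F)))
                      ≡ ι B * K + (E + F) * ι 6
    split E F L = trans (cong₂ (λ u v → L + (u + v) + ((ι B * K + (ι b₁ * E + ι b₂ * F)) - (L + (ι a₁ * E + ι a₂ * F))))
        (dist E (ι a₁) (ι b₁)) (dist F (ι a₂) (ι b₂)))
      (solve 8 (λ L N aE bE aF bF E F → L :+ ((aE :+ E :* con (ι 6) :- bE) :+ (aF :+ F :* con (ι 6) :- bF))
          :+ ((N :+ (bE :+ bF)) :- (L :+ (aE :+ aF))) := N :+ (E :+ F) :* con (ι 6))
        refl L (ι B * K) (ι a₁ * E) (ι b₁ * E) (ι a₂ * F) (ι b₂ * F) E F)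
      where
      dist : ∀ E a b → (a + ι 6 - b) * E ≡ a * E + E * ι 6 - b * E
      dist = solve 3 (λ E a b → (a :+ con (ι 6) :- b) :* E := a :* E :+ E :* con (ι 6) :- b :* E) refl

  -- A real number at most ½ may have approximations slightly above ½, while `Counting` demands
  -- `q ≤ ½`. So `q` is the minimum of `α` and ½, and a `d` small against `1 / k` keeps the `k`-th
  -- powers within a factor 2.
  clip : ∀ {α d} k → 0ℚ ≤ α → 0ℚ ≤ d → ι (2 ℕ.* k) * d ≤ 1ℚ → α ≤ ½ + ½ * d →
         ∃ λ q → 0ℚ ≤ q × q ≤ ½ × q ≤ α × α ^ k ≤ ι 2 * q ^ k
  clip {α} {d} k 0≤α 0≤d kd α≤ with α ℚ.≤? ½
  ... | yes α≤½ = α , 0≤α , α≤½ , ℚ.≤-refl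
      , ≤-by (α ^ k) (0≤^ k 0≤α) (solve 1 (λ z → z :+ z := con (ι 2) :* z) refl (α ^ k))
  ... | no  α≰½ = ½ , ℚ.<⇒≤ 0<½ , ℚ.≤-refl , ℚ.<⇒≤ (ℚ.≰⇒> α≰½)
      , close^ ½ d k (ℚ.<⇒≤ 0<½) 0≤d ℚ.≤-refl 0≤α kd α≤

  -- The approximation of log α may exceed that of log (1 - α) when α is close to
  -- ½; the latter is then replaced by the former.
  exponents-ordered : ∀ {m B e f a₁ b₁ a₂ b₂ α d} k → 0ℚ ≤ α → 0ℚ ≤ d → ι (2 ℕ.* k) * d ≤ 1ℚ → α ≤ ½ + ½ * d → α ≤ 1ℚ →
    (∀ q → 0ℚ ≤ q → q ≤ ½ → 2^ m * (q ^ e * (1ℚ - q) ^ f) ≤ 2^ B) →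
    2^ a₁ ≤ 2^ b₁ * α ^ k → 2^ a₂ ≤ 2^ b₂ * (1ℚ - α) ^ k →
    ∃ λ a → ∃ λ b →
      m ℕ.* k ℕ.+ (a₁ ℕ.* e ℕ.+ a ℕ.* f) ℕ.≤ B ℕ.* k ℕ.+ (suc b₁ ℕ.* e ℕ.+ b ℕ.* f)
      × a₁ ℕ.+ b ℕ.≤ a ℕ.+ suc b₁
      × (∀ z → ι b₂ + z ≤ ι a₂ + ι 5 → ι b + z ≤ ι a + ι 6)
  exponents-ordered {m} {B} {e} {f} {a₁} {b₁} {a₂} {b₂} {α} {d} k 0≤α 0≤d kd α≤ α≤1 count h₁ h₂ =
    choose (a₁ ℕ.+ b₂ ℕ.≤? a₂ ℕ.+ suc b₁)
    where
    clipped : ∃ λ q → 0ℚ ≤ q × q ≤ ½ × q ≤ α × α ^ k ≤ ι 2 * q ^ k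
    clipped = clip k 0≤α 0≤d kd α≤
    q : ℚ
    q = proj₁ clipped
    0≤q : 0ℚ ≤ q
    0≤q = proj₁ (proj₂ clipped)
    q≤½ : q ≤ ½
    q≤½ = proj₁ (proj₂ (proj₂ clipped))
    q≤α : q ≤ α
    q≤α = proj₁ (proj₂ (proj₂ (proj₂ clipped)))
    α^k : α ^ k ≤ ι 2 * q ^ k
    α^k = proj₂ (proj₂ (proj₂ (proj₂ clipped)))
    open Counting q 0≤q q≤½ using (q≤1-q; 0≤1-q)
    -- Raising `b₁` by one absorbs the factor 2 lost by clipping; this turns the error 5 into 6.
    g₁ : 2^ a₁ ≤ 2^ (suc b₁) * q ^ k
    g₁ = ℚ.≤-trans h₁ (ℚ.≤-trans (*-mono (2^ b₁) (ℚ.<⇒≤ (0<2^ b₁)) α^k)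
      (ℚ.≤-reflexive (trans (solve 3 (λ b t z → b :* (t :* z) := t :* b :* z) refl (2^ b₁) (ι 2) (q ^ k))
        (cong (_* q ^ k) (sym (ι-* 2 (2 ℕ.^ b₁)))))))
    g₂ : 2^ a₂ ≤ 2^ b₂ * (1ℚ - q) ^ k
    g₂ = ℚ.≤-trans h₂ (*-mono (2^ b₂) (ℚ.<⇒≤ (0<2^ b₂)) (^-mono k (0≤- α≤1) (ℚ.+-monoʳ-≤ 1ℚ (ℚ.neg-antimono-≤ q≤α))))
    g₂′ : 2^ a₁ ≤ 2^ (suc b₁) * (1ℚ - q) ^ k
    g₂′ = ℚ.≤-trans g₁ (*-mono (2^ (suc b₁)) (ℚ.<⇒≤ (0<2^ (suc b₁))) (^-mono k 0≤q q≤1-q))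
    five≤six : ∀ {a z} → z ≤ ι a + ι 5 → z ≤ ι a + ι 6
    five≤six {a} h = ℚ.≤-trans h (ℚ.+-monoʳ-≤ (ι a) (ι-mono (ℕ.n≤1+n 5)))
    Goal : ℕ → ℕ → Set
    Goal a b =
      m ℕ.* k ℕ.+ (a₁ ℕ.* e ℕ.+ a ℕ.* f) ℕ.≤ B ℕ.* k ℕ.+ (suc b₁ ℕ.* e ℕ.+ b ℕ.* f)
      × a₁ ℕ.+ b ℕ.≤ a ℕ.+ suc b₁
      × (∀ z → ι b₂ + z ≤ ι a₂ + ι 5 → ι b + z ≤ ι a + ι 6)
    choose : Dec (a₁ ℕ.+ b₂ ℕ.≤ a₂ ℕ.+ suc b₁) → ∃ λ a → ∃ λ b → Goal a b
    choose (yes le) = a₂ , b₂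
      , exponents {q} {1ℚ - q} {m} {B} {e} {f} {a₁} {suc b₁} {a₂} {b₂} k 0≤q 0≤1-q (count q 0≤q q≤½) g₁ g₂
      , le , λ z h → five≤six {a₂} h
    choose (no gt) = a₁ , suc b₁
      , exponents {q} {1ℚ - q} {m} {B} {e} {f} {a₁} {suc b₁} {a₁} {suc b₁} k 0≤q 0≤1-q (count q 0≤q q≤½) g₁ g₂′
      , ℕ.≤-refl , λ z h → five≤six {a₁} (≤-by ((ι a₂ + ι 5 - (ι b₂ + z)) + ((ι a₁ + ι b₂) - (ι a₂ + ι (suc b₁))))
          (0≤+ (0≤- h) (0≤- (subst₂ _≤_ (ι-+ a₂ (suc b₁)) (ι-+ a₁ b₂) (ι-mono (ℕ.<⇒≤ (ℕ.≰⇒> gt))))))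
          (solve 6 (λ a b c d z s → b :+ z :+ ((c :+ s :- (d :+ z)) :+ ((a :+ d) :- (c :+ b))) := a :+ s) refl
            (ι a₁) (ι (suc b₁)) (ι a₂) (ι b₂) z (ι 5)))

  -- Approximations of the entropy factor can be negative; then `0 ≤ B` takes over.
  scale : ∀ {p m t B} → 0ℚ ≤ p → p ≤ m → 0ℚ ≤ B → m * t ≤ B → p * t ≤ B
  scale {p} {m} {t} 0≤p p≤m 0≤B mt with ℚ.≤-total 0ℚ t
  ... | inj₁ 0≤t = ℚ.≤-trans (ℚ.*-monoʳ-≤-nonNeg t {{ℚ.nonNegative 0≤t}} p≤m) mt
  ... | inj₂ t≤0 = ℚ.≤-trans (ℚ.≤-trans (*-mono p 0≤p t≤0) (ℚ.≤-reflexive (ℚ.*-zeroʳ p))) 0≤B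

-- The entropy bound at `7 γ - 7`, and the number of errors from competitiveness.

module Bound (γ : ℝ) (1<γ : fromℕ 1 <ℝ γ) (γ≤15/14 : γ ≤ℝ fromℚ (+ 15 / 14)) where

  open import Data.Rational.Base using (_+_; _*_; -_; _-_; _≤_; _<_)
  open +-*-Solver
  open Arithmetic
  open LogarithmBounds

  α β : ℝ
  α = fromℕ 7 *ℝ γ -ℝ fromℕ 7
  β = fromℕ 8 -ℝ fromℕ 7 *ℝ γ

  0<α : fromℕ 0 <ℝ α
  0<α = 7γ-7>0 γ 1<γ

  0<β : fromℕ 0 <ℝ β
  0<β = 8-7γ>0 γ γ≤15/14

  β≡1-α : ∀ j → seq β j ≡ 1ℚ - seq α j
  β≡1-α j = solve 1 (λ g → con (ι 8) :+ :- (con (ι 7) :* g) := con 1ℚ :- (con (ι 7) :* g :+ :- con (ι 7))) refl (seq γ j)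

  eventually-positive : ∀ z → fromℕ 0 <ℝ z → ∃ λ N → ∀ j → N ℕ.≤ j → 0ℚ < seq z j
  eventually-positive z (ε , 0<ε , N , h) = N , λ j le →
    ℚ.<-≤-trans 0<ε (subst (_≤ seq z j) (ℚ.+-identityˡ ε) (h j le))

  α<1 : ∃ λ N → ∀ j → N ℕ.≤ j → seq α j < 1ℚ
  α<1 = proj₁ (eventually-positive β 0<β) , λ j le →
    subst₂ _<_ (ℚ.+-identityˡ (seq α j))
      (trans (cong (_+ seq α j) (β≡1-α j)) (solve 1 (λ a → con 1ℚ :- a :+ a := con 1ℚ) refl (seq α j)))
      (ℚ.+-monoˡ-< (seq α j) (proj₂ (eventually-positive β 0<β) j le))

  α≤½ : ∀ d → 0ℚ < d → ∃ λ N → ∀ j → N ℕ.≤ j → seq α j ≤ ½ + ½ * d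
  α≤½ d 0<d = proj₁ h , λ j le → bound (seq γ j) (proj₂ h j le)
    where
    h : ∃ λ N → ∀ j → N ℕ.≤ j → seq γ j ≤ + 15 / 14 + + 1 / 14 * d
    h = γ≤15/14 (+ 1 / 14 * d) (0<* (ℚ.positive⁻¹ (+ 1 / 14)) 0<d)
    bound : ∀ g → g ≤ + 15 / 14 + + 1 / 14 * d → ι 7 * g + - ι 7 ≤ ½ + ½ * d
    bound g le = ≤-by (ι 7 * (+ 15 / 14 + + 1 / 14 * d - g)) (0≤* (0≤ι 7) (0≤- le))
      (solve 2 (λ g d → con (ι 7) :* g :+ :- con (ι 7) :+ con (ι 7) :* (con (+ 15 / 14) :+ con (+ 1 / 14) :* d :- g)
                          := con ½ :+ con ½ :* d) refl g d)

  -- The logarithm of the counting inequality near `q = α`. The divisor 5 enters through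
  -- `n / 5 ≤ m`.
  entropy-bound : ∀ {n m e f B} → n ℕ.≤ m ℕ.* 5 → e ℕ.+ f ≡ m →
    (∀ q → 0ℚ ≤ q → q ≤ ½ → 2^ m * (q ^ e * (1ℚ - q) ^ f) ≤ 2^ B) →
    (∃ λ N → ∀ j → N ℕ.≤ j → ι e ≤ ι m * seq α j) →
    fromℚ (+ n / 5) *ℝ (fromℕ 1 +ℝ α *ℝ log₂ α 0<α +ℝ β *ℝ log₂ β 0<β) ≤ℝ fromℕ B
  entropy-bound {n} {m} {e} {f} {B} n≤5m e+f count (N₁ , he) ε 0<ε =
    with-logs (log₂-approx α 0<α (suc k)) (log₂-approx β 0<β (suc k))
    where
    -- The logarithms are known up to `6 / suc k`; over `m` bits this must add up to at most `ε`.
    k : ℕ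
    k = proj₁ (archimedes (ι m * ι 6) ε 0<ε)
    hk : ι m * ι 6 ≤ ι (suc k) * ε
    hk = proj₂ (archimedes (ι m * ι 6) ε 0<ε) (suc k) (ℕ.n≤1+n k)
    d-small : ∃ λ d → 0ℚ < d × ι (2 ℕ.* suc k) * d ≤ 1ℚ
    d-small = shrink (ι (2 ℕ.* suc k)) 1ℚ (0≤ι (2 ℕ.* suc k)) (ℚ.positive⁻¹ 1ℚ)
    d : ℚ
    d = proj₁ d-small
    0<d : 0ℚ < d
    0<d = proj₁ (proj₂ d-small)
    λ₁ λ₂ : ℕ → ℚ
    λ₁ = seq (log₂ α 0<α)
    λ₂ = seq (log₂ β 0<β)
    with-logs : (∃ λ a₁ → ∃ λ b₁ → ∃ λ N → ∀ j → N ℕ.≤ j →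
                  2^ a₁ ≤ 2^ b₁ * seq α j ^ suc k × ι b₁ + ι (suc k) * λ₁ j ≤ ι a₁ + ι 5) →
                (∃ λ a₂ → ∃ λ b₂ → ∃ λ N → ∀ j → N ℕ.≤ j →
                  2^ a₂ ≤ 2^ b₂ * seq β j ^ suc k × ι b₂ + ι (suc k) * λ₂ j ≤ ι a₂ + ι 5) →
                ∃ λ N → ∀ j → N ℕ.≤ j →
                  + n / 5 * (ι 1 + seq α j * λ₁ j + seq β j * λ₂ j) ≤ ι B + ε
    with-logs (a₁ , b₁ , N₂ , h₁) (a₂ , b₂ , N₃ , h₂) = J , conclude
      where
      N₄ N₅ N₆ J : ℕ
      N₄ = proj₁ (eventually-positive α 0<α)
      N₅ = proj₁ α<1
      N₆ = proj₁ (α≤½ d 0<d)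
      J  = N₁ ℕ.⊔ (N₂ ℕ.⊔ (N₃ ℕ.⊔ (N₄ ℕ.⊔ (N₅ ℕ.⊔ N₆))))
      ≥₁ : ∀ {j} → J ℕ.≤ j → N₁ ℕ.≤ j
      ≥₁ = ℕ.m⊔n≤o⇒m≤o N₁ _
      ≥₂₊ : ∀ {j} → J ℕ.≤ j → N₂ ℕ.⊔ (N₃ ℕ.⊔ (N₄ ℕ.⊔ (N₅ ℕ.⊔ N₆))) ℕ.≤ j
      ≥₂₊ = ℕ.m⊔n≤o⇒n≤o N₁ _
      ≥₂ : ∀ {j} → J ℕ.≤ j → N₂ ℕ.≤ j
      ≥₂ le = ℕ.m⊔n≤o⇒m≤o N₂ _ (≥₂₊ le)
      ≥₃₊ : ∀ {j} → J ℕ.≤ j → N₃ ℕ.⊔ (N₄ ℕ.⊔ (N₅ ℕ.⊔ N₆)) ℕ.≤ j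
      ≥₃₊ le = ℕ.m⊔n≤o⇒n≤o N₂ _ (≥₂₊ le)
      ≥₃ : ∀ {j} → J ℕ.≤ j → N₃ ℕ.≤ j
      ≥₃ le = ℕ.m⊔n≤o⇒m≤o N₃ _ (≥₃₊ le)
      ≥₄₊ : ∀ {j} → J ℕ.≤ j → N₄ ℕ.⊔ (N₅ ℕ.⊔ N₆) ℕ.≤ j
      ≥₄₊ le = ℕ.m⊔n≤o⇒n≤o N₃ _ (≥₃₊ le)
      ≥₄ : ∀ {j} → J ℕ.≤ j → N₄ ℕ.≤ j
      ≥₄ le = ℕ.m⊔n≤o⇒m≤o N₄ _ (≥₄₊ le)
      ≥₅ : ∀ {j} → J ℕ.≤ j → N₅ ℕ.≤ j
      ≥₅ le = ℕ.m⊔n≤o⇒m≤o N₅ N₆ (ℕ.m⊔n≤o⇒n≤o N₄ _ (≥₄₊ le))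
      ≥₆ : ∀ {j} → J ℕ.≤ j → N₆ ℕ.≤ j
      ≥₆ le = ℕ.m⊔n≤o⇒n≤o N₅ N₆ (ℕ.m⊔n≤o⇒n≤o N₄ _ (≥₄₊ le))
      0≤α : ∀ j → J ℕ.≤ j → 0ℚ ≤ seq α j
      0≤α j le = ℚ.<⇒≤ (proj₂ (eventually-positive α 0<α) j (≥₄ le))
      α≤1 : ∀ j → J ℕ.≤ j → seq α j ≤ 1ℚ
      α≤1 j le = ℚ.<⇒≤ (proj₂ α<1 j (≥₅ le))
      -- These inequalities between naturals do not mention the index, so evaluating `α` at `J`
      -- alone settles them for every later `j`.
      chosen : ∃ λ a → ∃ λ b →
        m ℕ.* suc k ℕ.+ (a₁ ℕ.* e ℕ.+ a ℕ.* f) ℕ.≤ B ℕ.* suc k ℕ.+ (suc b₁ ℕ.* e ℕ.+ b ℕ.* f)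
        × a₁ ℕ.+ b ℕ.≤ a ℕ.+ suc b₁
        × (∀ z → ι b₂ + z ≤ ι a₂ + ι 5 → ι b + z ≤ ι a + ι 6)
      chosen = exponents-ordered {m} {B} {e} {f} {a₁} {b₁} {a₂} {b₂} {seq α J} {d} (suc k)
        (0≤α J ℕ.≤-refl) (ℚ.<⇒≤ 0<d) (proj₂ (proj₂ d-small))
        (proj₂ (α≤½ d 0<d) J (≥₆ ℕ.≤-refl)) (α≤1 J ℕ.≤-refl) count (proj₁ (h₁ J (≥₂ ℕ.≤-refl)))
        (subst (λ z → 2^ a₂ ≤ 2^ b₂ * z ^ suc k) (β≡1-α J) (proj₁ (h₂ J (≥₃ ℕ.≤-refl))))
      conclude : ∀ j → J ℕ.≤ j → + n / 5 * (ι 1 + seq α j * λ₁ j + seq β j * λ₂ j) ≤ ι B + ε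
      conclude j le = scale {m = ι m} (0≤fifth n) (fifth≤ {n} {m} n≤5m) (0≤+ (0≤ι B) (ℚ.<⇒≤ 0<ε))
        (subst (λ z → ι m * (1ℚ + seq α j * λ₁ j + z * λ₂ j) ≤ ι B + ε) (sym (β≡1-α j))
          (log-count {m} {B} {e} {f} {a₁} {suc b₁} {proj₁ chosen} {proj₁ (proj₂ chosen)} {k} e+f
            (0≤α j le) (0≤- (α≤1 j le)) (he j (≥₁ le))
            (proj₁ (proj₂ (proj₂ chosen))) (proj₁ (proj₂ (proj₂ (proj₂ chosen))))
            first (proj₂ (proj₂ (proj₂ (proj₂ chosen))) (ι (suc k) * λ₂ j) (proj₂ (h₂ j (≥₃ le)))) hk))
        where
        first : ι (suc b₁) + ι (suc k) * λ₁ j ≤ ι a₁ + ι 6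
        first = ≤-by (ι a₁ + ι 5 - (ι b₁ + ι (suc k) * λ₁ j)) (0≤- (proj₂ (h₁ j (≥₂ le))))
          (trans (cong (λ z → z + ι (suc k) * λ₁ j + (ι a₁ + ι 5 - (ι b₁ + ι (suc k) * λ₁ j))) (ι-suc b₁))
            (solve 3 (λ a b z → con 1ℚ :+ b :+ z :+ (a :+ con (ι 5) :- (b :+ z)) := a :+ con (ι 6)) refl
              (ι a₁) (ι b₁) (ι (suc k) * λ₁ j)))

  -- OPT is at most 6m, with the padding, which leaves m (γ - 1) for the rounding
  -- of the reals.
  few-errors : ∀ {m r e c} → r ℕ.≤ 2 → suc m ℕ.* 4 ℕ.+ r ℕ.+ e ℕ.≤ c → fromℕ c ≤ℝ γ *ℝ fromℕ (suc m ℕ.* 4 ℕ.+ r) →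
               ∃ λ N → ∀ j → N ℕ.≤ j → ι e ≤ ι (suc m) * seq α j
  few-errors {m} {r} {e} {c} r≤2 e≤ comp = N₀ ℕ.⊔ N₁ , λ j le →
      bound (seq γ j) (proj₂ (proj₂ (proj₂ 1<γ)) j (ℕ.m⊔n≤o⇒m≤o N₀ N₁ le)) (proj₂ h j (ℕ.m⊔n≤o⇒n≤o N₀ N₁ le))
    where
    opt : ℕ
    opt = suc m ℕ.* 4 ℕ.+ r
    ε : ℚ
    ε = proj₁ 1<γ
    0<ε : 0ℚ < ε
    0<ε = proj₁ (proj₂ 1<γ)
    h : ∃ λ N → ∀ j → N ℕ.≤ j → ι c ≤ seq γ j * ι opt + ε
    h = comp ε 0<ε
    N₀ N₁ : ℕ
    N₀ = proj₁ (proj₂ (proj₂ 1<γ))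
    N₁ = proj₁ h
    opt≤ : opt ℕ.≤ suc m ℕ.* 6
    opt≤ = ℕ.≤-trans (ℕ.+-monoʳ-≤ (suc m ℕ.* 4) (ℕ.≤-trans r≤2 (ℕ.m≤m+n 2 (m ℕ.* 2))))
      (ℕ.≤-reflexive (sym (ℕ.*-distribˡ-+ (suc m) 4 2)))
    bound : ∀ g → 1ℚ + ε ≤ g → ι c ≤ g * ι opt + ε → ι e ≤ ι (suc m) * (ι 7 * g + - ι 7)
    bound g εg cg = begin
      ι e
        ≤⟨ ≤-by (g * O + ε - (O + ι e)) (0≤- (ℚ.≤-trans (subst (_≤ ι c) (ι-+ opt e) (ι-mono e≤)) cg))
             (solve 4 (λ e g O ε → e :+ (g :* O :+ ε :- (O :+ e)) := (g :- con 1ℚ) :* O :+ con 1ℚ :* ε) refl (ι e) g O ε) ⟩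
      (g - 1ℚ) * O + 1ℚ * ε
        ≤⟨ ℚ.+-mono-≤ (*-mono (g - 1ℚ) 0≤g-1 (subst (O ≤_) (ι-* (suc m) 6) (ι-mono opt≤)))
             (*-mono₂ (0≤ι 1) 0≤g-1 (ι-mono (s≤s (z≤n {m}))) ε≤g-1) ⟩
      (g - 1ℚ) * (ι (suc m) * ι 6) + ι (suc m) * (g - 1ℚ)
        ≡⟨ solve 2 (λ g M → (g :- con 1ℚ) :* (M :* con (ι 6)) :+ M :* (g :- con 1ℚ)
                              := M :* (con (ι 7) :* g :+ :- con (ι 7))) refl g (ι (suc m)) ⟩
      ι (suc m) * (ι 7 * g + - ι 7) ∎
      where
      open ℚ.≤-Reasoning
      O : ℚ
      O = ι opt
      ε≤g-1 : ε ≤ g - 1ℚ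
      ε≤g-1 = ≤-by (g - (1ℚ + ε)) (0≤- εg) (solve 2 (λ g ε → ε :+ (g :- (con 1ℚ :+ ε)) := g :- con 1ℚ) refl g ε)
      0≤g-1 : 0ℚ ≤ g - 1ℚ
      0≤g-1 = ℚ.≤-trans (ℚ.<⇒≤ 0<ε) ε≤g-1

-- Application to an advice algorithm.

module LowerBound (γ : ℝ) (1<γ : fromℕ 1 <ℝ γ) (γ≤15/14 : γ ≤ℝ fromℚ (+ 15 / 14)) where

  open import Data.Rational.Base using (_+_; _*_; -_; _-_; _≤_)
  open Arithmetic
  open Bound γ 1<γ γ≤15/14

  entropy : ℝ
  entropy = fromℕ 1 +ℝ α *ℝ log₂ α 0<α +ℝ β *ℝ log₂ β 0<β

  module _ {k} {x y : Fin (suc (suc k))} (x≢y : x ≢ y) (rest : Vec (Fin (suc (suc k))) k)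
           (ALG : AdviceAlgorithm (suc (suc k))) (competitive : Competitive γ (x ∷ y ∷ rest) ALG) where

    open TwoItems x≢y
    open AdviceAlgorithm ALG using (strategy; oracle; schedule; run)

    L₀ : Vec (Fin (suc (suc k))) (suc (suc k))
    L₀ = x ∷ y ∷ rest

    answers : ∀ {m} r → Vec Bool m → Vec Bool m
    answers r s = guesses r L₀ true s (schedule (requests r true s))

    answer-errors : ∀ {m r} → r ℕ.≤ 2 → (s : Vec Bool (suc m)) →
                 ∃ λ N → ∀ j → N ℕ.≤ j → ι (distance s (answers r s)) ≤ ι (suc m) * seq α j
    answer-errors {m} {r} r≤2 s = few-errors {m} {r} r≤2 (errors≤ rest r s (schedule (requests r true s)))
      (competitive (requests r true s) (suc m ℕ.* 4 ℕ.+ r) (requests-OPT rest r s))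

    long : ∀ m r → r ℕ.≤ 2 → ∃ λ σ → fromℚ (+ (suc m ℕ.* 3 ℕ.+ r) / 5) *ℝ entropy ≤ℝ fromℕ (bitsRead ALG σ)
    long m r r≤2 = requests r true s , entropy-bound {suc m ℕ.* 3 ℕ.+ r} {suc m} {e} {suc m ℕ.∸ e} {B}
        -- With at least one block, three requests per block and at most two extra ones make at most
        -- five per block.
        (ℕ.≤-trans (ℕ.+-monoʳ-≤ (suc m ℕ.* 3) (ℕ.≤-trans r≤2 (ℕ.m≤m+n 2 (m ℕ.* 2))))
          (ℕ.≤-reflexive (sym (ℕ.*-distribˡ-+ (suc m) 3 2))))
        (ℕ.m+[n∸m]≡n (distance≤ t (answers r t)))
        (λ q 0≤q q≤½ → Counting.counting q 0≤q q≤½ {B = B} {e = e} (λ u → oracle (requests r true u)) (answers r) causal most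
          (ℕ.m+[n∸m]≡n (distance≤ t (answers r t))))
        (answer-errors {m} {r} r≤2 t)
      where
      -- Two worst cases: `s` reads the most bits and is the input returned, while `t` has the most
      -- errors and supplies a common `e`.
      s t : Vec Bool (suc m)
      s = proj₁ (maximum (suc m) (λ u → bitsRead ALG (requests r true u)))
      t = proj₁ (maximum (suc m) (λ u → distance u (answers r u)))
      most : ∀ u → distance u (answers r u) ℕ.≤ distance t (answers r t)
      most = proj₂ (maximum (suc m) (λ u → distance u (answers r u)))
      B e : ℕ
      B = bitsRead ALG (requests r true s)
      e = distance t (answers r t)
      read≤ : ∀ u → bitsRead ALG (requests r true u) ℕ.≤ B
      read≤ = proj₂ (maximum (suc m) (λ u → bitsRead ALG (requests r true u)))
      causal : ∀ u v → (∀ i → i ℕ.< B → oracle (requests r true u) i ≡ oracle (requests r true v) i) →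
               Causal u (answers r u) v (answers r v)
      causal u v same = guesses-causal same r L₀ true u v (read≤ u) (read≤ v)
        (run (requests r true u)) (run (requests r true v))

    -- A single block leaves no room for an error, so both guesses of an
    -- uninformed answer to the first request are refuted.
    informed : ∀ {a} → ¬ strategy (request y ∷ []) ≡ act a
    informed {a} acts-a = refute (ahead (nextList L₀ y a))
        (λ c → trans (sym (answer c (run (requests 0 true (c ∷ []))))) (no-errors c))
      where
      answer : ∀ c {φ as b} → Run strategy φ [] (requests 0 true (c ∷ [])) as b →
               distance (c ∷ []) (guesses 0 L₀ true (c ∷ []) as) ≡ mismatch (ahead (nextList L₀ y a)) c ℕ.+ 0
      answer c (acts p ∷ (_ ∷ (_ ∷ []))) with trans (sym p) acts-a
      ... | refl = refl
      answer c (reads p _ ∷ (_ ∷ (_ ∷ []))) with trans (sym p) acts-a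
      ... | ()
      none : ∀ {c} → (∃ λ N → ∀ j → N ℕ.≤ j → ι c ≤ ι 1 * seq α j) → c ≡ 0
      none {zero}  _       = refl
      none {suc c} (N , h) = ⊥-elim (<⇒≱ (proj₂ α<1 J (ℕ.m≤n⊔m N (proj₁ α<1)))
        (ℚ.≤-trans (ι-mono (s≤s (z≤n {c}))) (subst (ι (suc c) ≤_) (ℚ.*-identityˡ (seq α J)) (h J (ℕ.m≤m⊔n N (proj₁ α<1))))))
        where
        J : ℕ
        J = N ℕ.⊔ proj₁ α<1
      no-errors : ∀ c → distance (c ∷ []) (answers 0 (c ∷ [])) ≡ 0
      no-errors c = none (answer-errors {0} {0} z≤n (c ∷ []))
      refute : ∀ g → (∀ c → mismatch g c ℕ.+ 0 ≡ 0) → ⊥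
      refute true  h with h false
      ... | ()
      refute false h with h true
      ... | ()

    -- As `n / 5 ≤ 1`, one bit suffices when `n` is positive: it gives the counting inequality
    -- `2 (1 - q) ≤ 2 ≤ 2^ B` for one guess without errors. By `informed`, a sequence starting with
    -- `y` forces that bit to be read.
    short : ∀ n → n ℕ.≤ 5 → ∃ λ (σ : Vec (Fin (suc (suc k))) n) → fromℚ (+ n / 5) *ℝ entropy ≤ℝ fromℕ (bitsRead ALG σ)
    short zero _ = [] , entropy-bound {0} {0} {0} {0} {bitsRead ALG []} z≤n refl (λ _ _ _ → 2^-mono (z≤n {bitsRead ALG []}))
      (0 , λ j _ → ℚ.≤-reflexive (sym (ℚ.*-zeroˡ (seq α j))))
    short (suc n) n≤5 = σ , entropy-bound {suc n} {1} {0} {1} {bitsRead ALG σ} n≤5 refl count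
        (proj₁ (eventually-positive α 0<α) , λ j le → 0≤* (0≤ι 1) (ℚ.<⇒≤ (proj₂ (eventually-positive α 0<α) j le)))
      where
      σ : Vec (Fin (suc (suc k))) (suc n)
      σ = y ∷ replicate n y
      reading : ∀ {φ as b} → Run strategy φ [] σ as b → 1 ℕ.≤ b
      reading (acts p ∷ _)                             = ⊥-elim (informed p)
      reading (_∷_ {c = c} (reads {i} {b = b} _ _) _)  =
        ℕ.≤-trans (s≤s z≤n) (ℕ.≤-trans (ℕ.m≤m⊔n (suc i) b) (ℕ.m≤m⊔n (suc i ℕ.⊔ b) c))
      count : ∀ q → 0ℚ ≤ q → q ≤ ½ → 2^ 1 * (1ℚ * ((1ℚ - q) * 1ℚ)) ≤ 2^ (bitsRead ALG σ)
      count q 0≤q q≤½ = ℚ.≤-trans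
        (*-mono (2^ 1) (ℚ.<⇒≤ (0<2^ 1)) (subst (_≤ 1ℚ) (sym (trans (ℚ.*-identityˡ _) (ℚ.*-identityʳ (1ℚ - q))))
          (≤-by q 0≤q (trans (ℚ.+-assoc 1ℚ (- q) q) (trans (cong (λ z → 1ℚ + z) (ℚ.+-inverseˡ q)) (ℚ.+-identityʳ 1ℚ))))))
        (2^-mono (reading (run σ)))

    bound : ∀ n → ∃ λ (σ : Vec (Fin (suc (suc k))) n) → fromℚ (+ n / 5) *ℝ entropy ≤ℝ fromℕ (bitsRead ALG σ)
    bound n = by-blocks (n ℕ./ 3) (ℕ.s≤s⁻¹ (m%n<n n 3)) (trans (m≡m%n+[m/n]*n n 3) (ℕ.+-comm (n ℕ.% 3) (n ℕ./ 3 ℕ.* 3)))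
      where
      by-blocks : ∀ {n r} m → r ℕ.≤ 2 → n ≡ m ℕ.* 3 ℕ.+ r →
                  ∃ λ (σ : Vec (Fin (suc (suc k))) n) → fromℚ (+ n / 5) *ℝ entropy ≤ℝ fromℕ (bitsRead ALG σ)
      by-blocks {n} zero    r≤2 refl = short n (ℕ.≤-trans r≤2 (ℕ.m≤m+n 2 3))
      by-blocks {r = r} (suc m) r≤2 refl = long m r r≤2

open import Data.Nat.Base using (_≤_)

theorem2 : (γ : ℝ) (1<γ : fromℕ 1 <ℝ γ) (γ≤15/14 : γ ≤ℝ fromℚ (+ 15 / 14))
    (l : ℕ) → 2 ≤ l → (L₀ : Vec (Fin l) l) → Unique L₀ →
    (ALG : AdviceAlgorithm l) → Competitive γ L₀ ALG →
    (n : ℕ) → ∃ λ (σ : Vec (Fin l) n) →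
    fromℚ (+ n / 5) *ℝ
    (fromℕ 1
    +ℝ (fromℕ 7 *ℝ γ -ℝ fromℕ 7) *ℝ log₂ (fromℕ 7 *ℝ γ -ℝ fromℕ 7) (7γ-7>0 γ 1<γ)
    +ℝ (fromℕ 8 -ℝ fromℕ 7 *ℝ γ) *ℝ log₂ (fromℕ 8 -ℝ fromℕ 7 *ℝ γ) (8-7γ>0 γ γ≤15/14))
    ≤ℝ fromℕ (bitsRead ALG σ)
theorem2 γ 1<γ γ≤15/14 (suc (suc k)) (s≤s (s≤s z≤n)) (x ∷ y ∷ rest) ((x≢y All.∷ _) ∷ _) ALG competitive =
  LowerBound.bound γ 1<γ γ≤15/14 x≢y rest ALG competitive
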